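{- (Safety, deadlock-freedom and liveness by projection.) Let $G$ be a global type without runtime constructs (no en-route transmissions and no crash annotations), and let $\mathscr R$ be a set of reliable roles. If $\Gamma$ is a typing context associated with $G$, i.e. $\Gamma;\Delta_\epsilon\sqsubseteq_{\mathscr R}\langle\emptyset;G\rangle$ where $\Delta_\epsilon$ is the queue environment in which all queues are empty, then $\Gamma;\Delta_\epsilon$ is $\mathscr R$-safe, $\mathscr R$-deadlock-free, and $\mathscr R$-live.
   Context: **Basics.** Fix a set $\mathsf{Role}$ of roles ($p,q,r,\dots$), a set of message labels containing a special label $\mathsf{crash}$, a set of basic types $B$ ($\mathsf{nat},\mathsf{int},\mathsf{bool},\mathsf{str},\mathsf{unit},\dots$), and a set $\mathscr R\subseteq\mathsf{Role}$ of reliable roles (a fixed parameter). Payloads of $\mathsf{crash}$ branches are irrelevant and omitted. **Global types.** $G ::= p\to q^{?}:\{m_i(B_i).G_i\}_{i\in I}\mid p^{?}\rightsquigarrow q:j\,\{m_i(B_i).G_i\}_{i\in I}\ (j\in I)\mid \mu t.G\mid t\mid\mathsf{end}$, where $p^{?}$ stands for either $p$ (live) or $p^{\bot}$ (annotated as crashed). The second form is a message en route with chosen index $j$; it and the annotation $\bot$ are the runtime constructs. Requirements: $I\neq\emptyset$, labels $m_i$ pairwise distinct, $p\neq q$, $\{m_i\mid i\in I\}\neq\{\mathsf{crash}\}$, recursion is contractive (guarded), and global types are closed. **Live roles** $\mathrm{roles}(G)$ and **crashed roles** $\mathrm{roles}^{\bot}(G)$ are the least sets with: $\mathrm{roles}(p\to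 q:\{m_i(B_i).G_i\}_{i\in I})=\{p,q\}\cup\bigcup_i\mathrm{roles}(G_i)$ and $\mathrm{roles}^\bot$ of it $=\bigcup_i\mathrm{roles}^\bot(G_i)$; $\mathrm{roles}(p\to q^\bot:\{\dots\})=\{p\}\cup\bigcup_i\mathrm{roles}(G_i)$ and $\mathrm{roles}^\bot$ of it $=\{q\}\cup\bigcup_i\mathrm{roles}^\bot(G_i)$; $\mathrm{roles}(p^?\rightsquigarrow q:j\{\dots\})=\{q\}\cup\bigcup_i\mathrm{roles}(G_i)$ and $\mathrm{roles}^\bot$ of it $=\bigcup_i\mathrm{roles}^\bot(G_i)$; both are $\emptyset$ on $\mathsf{end}$ and $t$; on $\mu t.G$ both equal their value on $G[\mu t.G/t]$. **Local types.** $S,T ::= p\&\{m_i(B_i).T_i\}_{i\in I}$ (receive from $p$) $\mid p\oplus\{m_i(B_i).T_i\}_{i\in I}$ (send to $p$) $\mid\mu t.T\mid t\mid\mathsf{end}\mid\mathsf{stop}$, with $I\ne\emptyset$, distinct labels, contractive recursion; $\mathsf{crash}$ never occurs in a $\oplus$, and is never the only label of a $\&$. **Merge** $\sqcap$ (partial; branches/indices identified by label): $p\&\{m_i(B_i).S_i\}_{i\in I}\sqcap p\&\{m_j(B_j).T_j\}_{j\in J}$ is the external choice from $p$ with branches $m_k(B_k).(S_k\sqcap T_k)$ for $k\in I\cap J$, $m_i(B_i).S_i$ for $i\in I\setminus J$, $m_j(B_j).T_j$ for $j\in J\setminus I$; $p\oplus\{m_i(B_i).S_i\}_{i\in I}\sqcap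 p\oplus\{m_i(B_i).T_i\}_{i\in I}=p\oplus\{m_i(B_i).(S_i\sqcap T_i)\}_{i\in I}$; $\mu t.S\sqcap\mu t.T=\mu t.(S\sqcap T)$; $t\sqcap t=t$; $\mathsf{end}\sqcap\mathsf{end}=\mathsf{end}$; undefined otherwise. **Projection** $G{\upharpoonright_{\mathscr R}}p$ (partial). (i) $(q\to r^?:\{m_i(B_i).G_i\}_{i\in I}){\upharpoonright_{\mathscr R}}p$ is: $r\oplus\{m_i(B_i).(G_i{\upharpoonright_{\mathscr R}}p)\}_{i\in I,\,m_i\neq\mathsf{crash}}$ if $p=q$; $q\&\{m_i(B_i).(G_i{\upharpoonright_{\mathscr R}}p)\}_{i\in I}$ if $p=r$ and ($q\notin\mathscr R$ implies $\exists k\in I: m_k=\mathsf{crash}$); $\sqcap_{i\in I}(G_i{\upharpoonright_{\mathscr R}}p)$ if $p\notin\{q,r\}$. (ii) $(q^?\rightsquigarrow r:j\{m_i(B_i).G_i\}_{i\in I}){\upharpoonright_{\mathscr R}}p$ is: $G_j{\upharpoonright_{\mathscr R}}p$ if $p=q$; the same as in (i) if $p=r$ (same side condition) or $p\notin\{q,r\}$. (iii) $(\mu t.G){\upharpoonright_{\mathscr R}}p=\mu t.(G{\upharpoonright_{\mathscr R}}p)$ if $p$ occurs in $G$ or $\mu t.G$ has free type variables, else $\mathsf{end}$; $t{\upharpoonright_{\mathscr R}}p=t$; $\mathsf{end}{\upharpoonright_{\mathscr R}}p=\mathsf{end}$. **Subtyping** $\leqslant$ is coinductively defined by: $\mathsf{end}\leqslant\mathsf{end}$;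 $\mathsf{stop}\leqslant\mathsf{stop}$; $p\&\{m_i(B_i).T_i\}_{i\in I\cup J}\leqslant p\&\{m_i(B_i).T'_i\}_{i\in I}$ if $T_i\leqslant T'_i$ for all $i\in I$, $\{m_k\mid k\in I\}\ne\{\mathsf{crash}\}$, and no $j\in J$ has $m_j=\mathsf{crash}$; $p\oplus\{m_i(B_i).T_i\}_{i\in I}\leqslant p\oplus\{m_i(B_i).T'_i\}_{i\in I\cup J}$ if $T_i\leqslant T_i'$ for all $i\in I$; $\mu t.T\leqslant T'$ if $T[\mu t.T/t]\leqslant T'$; $T\leqslant\mu t.T'$ if $T\leqslant T'[\mu t.T'/t]$. **Well-annotated.** For $\mathscr C\subseteq\mathsf{Role}$ (crashed roles), $\langle\mathscr C;G\rangle$ is well-annotated w.r.t. $\mathscr R$ iff $\mathrm{roles}^\bot(G)\cap\mathscr R=\emptyset$, $\mathrm{roles}^\bot(G)\subseteq\mathscr C$, and $\mathrm{roles}(G)\cap\mathrm{roles}^\bot(G)=\emptyset$. **Configurations.** A configuration $\Gamma;\Delta$ consists of a typing context $\Gamma$ (a partial map from roles to local types) and a queue environment $\Delta$ assigning to each ordered pair of roles a queue $\Delta(p,q)$ (messages from $p$ to $q$), which is either a finite sequence of messages $m(B)$ ($\epsilon$ is the empty one) or the unavailable queue $\oslash$. $\Gamma[p\mapsto T]$, $\Delta[p,q\mapsto\tau]$ denote updates; $\Delta[\cdot,q\mapsto\oslash]$ sets $\Delta(p,q)$ to $\oslash$ for all $p$; $\Delta(\cdot,q)=\oslash$ means $\Delta(p,q)=\oslash$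 for all $p$. Appending to an unavailable queue discards the message: $\oslash\cdot m(B)=\oslash$. **Transition labels.** $\alpha ::= p\&q:m(B)$ ($p$ receives from $q$) $\mid p\oplus q:m(B)$ ($p$ sends to $q$) $\mid\mathsf{cr}(p)$ ($p$ crashes) $\mid\mathsf{det}(p,q)$ ($p$ detects the crash of $q$). **Configuration reductions** $\Gamma;\Delta\xrightarrow{\alpha}\Gamma';\Delta'$, inductively: (send) if $\Gamma(p)=q\oplus\{m_i(B_i).T_i\}_{i\in I}$, $k\in I$: $\Gamma;\Delta\xrightarrow{p\oplus q:m_k(B_k)}\Gamma[p\mapsto T_k];\Delta[p,q\mapsto\Delta(p,q)\cdot m_k(B_k)]$; (receive) if $\Gamma(p)=q\&\{m_i(B_i).T_i\}_{i\in I}$, $k\in I$, $\Delta(q,p)=m_k(B_k)\cdot\tau\ne\oslash$: $\Gamma;\Delta\xrightarrow{p\&q:m_k(B_k)}\Gamma[p\mapsto T_k];\Delta[q,p\mapsto\tau]$; (rec) if $\Gamma(p)=\mu t.T$ and $\Gamma[p\mapsto T[\mu t.T/t]];\Delta\xrightarrow{\alpha}\Gamma';\Delta'$ then $\Gamma;\Delta\xrightarrow{\alpha}\Gamma';\Delta'$; (crash) if $\Gamma(p)\ne\mathsf{end}$ and $\Gamma(p)\neq\mathsf{stop}$: $\Gamma;\Delta\xrightarrow{\mathsf{cr}(p)}\Gamma[p\mapsto\mathsf{stop}];\Delta[\cdot,p\mapsto\oslash]$; (detect) if $\Gamma(q)=p\&\{m_i(B_i).T_i\}_{i\in I}$, $\Gamma(p)=\mathsf{stop}$,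 $k\in I$, $m_k=\mathsf{crash}$, $\Delta(p,q)=\epsilon$: $\Gamma;\Delta\xrightarrow{\mathsf{det}(q,p)}\Gamma[q\mapsto T_k];\Delta$. Write $\to$ (unlabelled, without subscript) for a reduction whose label is a send, receive or detection (not a crash); write $\to_{\mathscr R}$ for a reduction whose label is not $\mathsf{cr}(r)$ with $r\in\mathscr R$; $\to^*_{\mathscr R}$ is the reflexive transitive closure. $\Gamma;\Delta\xrightarrow{\alpha}$ means some such reduction exists. **Association.** $\Gamma;\Delta\sqsubseteq_{\mathscr R}\langle\mathscr C;G\rangle$, for $\langle\mathscr C;G\rangle$ well-annotated w.r.t. $\mathscr R$, holds iff: (1) $\Gamma$ splits into disjoint (possibly empty) $\Gamma_G,\Gamma_{\mathsf{stop}},\Gamma_{\mathsf{end}}$ with $\mathrm{dom}(\Gamma_G)=\mathrm{roles}(G)$ and $\Gamma(p)\leqslant G{\upharpoonright_{\mathscr R}}p$ for all $p\in\mathrm{dom}(\Gamma_G)$; $\mathrm{dom}(\Gamma_{\mathsf{stop}})=\mathscr C$ and $\Gamma(p)=\mathsf{stop}$ for all $p\in\mathscr C$; $\Gamma(p)=\mathsf{end}$ for all $p\in\mathrm{dom}(\Gamma_{\mathsf{end}})$; and (2) $\Delta$ is associated with $\langle\mathscr C;G\rangle$, meaning (recursively on $G$): (a) for all $q$: $q\in\mathscr C\iff\Delta(\cdot,q)=\oslash$; (b) if $G=\mathsf{end}$ or $G=\mu t.G'$ then $\Delta(p,q)=\epsilon$ for all $p$ and all $q\notin\mathscr C$; (c)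 if $G=p\to q^?:\{m_i(B_i).G_i\}_{i\in I}$, or $G=p^?\rightsquigarrow q:j\{m_i(B_i).G_i\}_{i\in I}$ with $m_j=\mathsf{crash}$, then $\Delta(p,q)=\epsilon$ if $q$ is not annotated as crashed, and $\Delta$ is associated with $\langle\mathscr C;G_i\rangle$ for all $i\in I$; (d) if $G=p^?\rightsquigarrow q:j\{m_i(B_i).G_i\}_{i\in I}$ with $m_j\neq\mathsf{crash}$, then $\Delta(p,q)=m_j(B_j)\cdot\tau$ for some $\tau$ and $\Delta[p,q\mapsto\tau]$ is associated with $\langle\mathscr C;G_i\rangle$ for all $i\in I$. **Safety.** A predicate $\varphi$ on configurations is an $\mathscr R$-safety property iff whenever $\varphi(\Gamma;\Delta)$: (S1) if $\Gamma(q)=p\&\{m_i(B_i).S_i\}_{i\in I}$, $\Delta(p,q)\ne\oslash$ and $\Delta(p,q)\neq\epsilon$, then $\Gamma;\Delta\xrightarrow{q\&p:m'(B')}$ for some $m',B'$; (S2) if $\Gamma(p)=\mathsf{stop}$, $\Gamma(q)=p\&\{m_i(B_i).S_i\}_{i\in I}$ and $\Delta(p,q)=\epsilon$, then $\Gamma;\Delta\xrightarrow{\mathsf{det}(q,p)}$; (S3) if $\Gamma(p)=\mu t.S$ then $\varphi(\Gamma[p\mapsto S[\mu t.S/t]];\Delta)$; (S4) if $\Gamma;\Delta\to_{\mathscr R}\Gamma';\Delta'$ then $\varphi(\Gamma';\Delta')$. $\Gamma;\Delta$ is $\mathscr R$-safe iff $\varphi(\Gamma;\Delta)$ for some $\mathscr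 R$-safety property $\varphi$. **Deadlock-freedom.** $\Gamma;\Delta$ is $\mathscr R$-deadlock-free iff it is $\mathscr R$-safe and whenever $\Gamma;\Delta\to^*_{\mathscr R}\Gamma';\Delta'$ and $\Gamma';\Delta'$ has no $\to_{\mathscr R}$ reduction, then $\Gamma'(p)\in\{\mathsf{end},\mathsf{stop}\}$ for all $p\in\mathrm{dom}(\Gamma')$, and for all $p,q$: $\Delta'(\cdot,q)=\oslash$ if $\Gamma'(q)=\mathsf{stop}$, and $\Delta'(p,q)=\epsilon$ otherwise. **Liveness.** A non-crashing path is a possibly infinite sequence $(\Gamma_n;\Delta_n)_{n\in N}$, $N=\{0,1,2,\dots\}$ a (finite or infinite) set of consecutive naturals, with $\Gamma_n;\Delta_n\to\Gamma_{n+1};\Delta_{n+1}$ for all $n$ with $n,n+1\in N$. It is fair iff for all $n\in N$: (F1) $\Gamma_n;\Delta_n\xrightarrow{p\oplus q:m(B)}$ implies there are $k\in N$, $k\ge n$, $m',B'$ with $\Gamma_k;\Delta_k\xrightarrow{p\oplus q:m'(B')}\Gamma_{k+1};\Delta_{k+1}$; (F2) $\Gamma_n;\Delta_n\xrightarrow{p\&q:m(B)}$ implies there is $k\in N$, $k\ge n$, with $\Gamma_k;\Delta_k\xrightarrow{p\&q:m(B)}\Gamma_{k+1};\Delta_{k+1}$; (F3) $\Gamma_n;\Delta_n\xrightarrow{\mathsf{det}(p,q)}$ implies there is $k\in N$, $k\ge n$, with $\Gamma_k;\Delta_k\xrightarrow{\mathsf{det}(p,q)}\Gamma_{k+1};\Delta_{k+1}$.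 It is live iff for all $n\in N$: (L1) $\Delta_n(p,q)=m(B)\cdot\tau\neq\oslash$ and $m\ne\mathsf{crash}$ implies there is $k\in N$, $k\ge n$, with $\Gamma_k;\Delta_k\xrightarrow{q\&p:m(B)}\Gamma_{k+1};\Delta_{k+1}$; (L2) $\Gamma_n(p)=q\&\{m_i(B_i).T_i\}_{i\in I}$ implies there are $k\in N$, $k\geq n$, $m',B'$ with $\Gamma_k;\Delta_k\xrightarrow{p\&q:m'(B')}\Gamma_{k+1};\Delta_{k+1}$ or $\Gamma_k;\Delta_k\xrightarrow{\mathsf{det}(p,q)}\Gamma_{k+1};\Delta_{k+1}$. $\Gamma;\Delta$ is $\mathscr R$-live iff it is $\mathscr R$-safe and $\Gamma;\Delta\to^*_{\mathscr R}\Gamma';\Delta'$ implies that all fair non-crashing paths starting with $\Gamma';\Delta'$ are live.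
   Formalization: Contractive recursion in the local types of Γ is read as excluding vacuous recursions such as μt.end (a body must reach a communication or an outer variable); with them a reliable role can get stuck at μt.end, which is neither end nor stop, and deadlock-freedom fails. -}

module Defs where

open import Level using (0ℓ)
open import Data.Bool using (if_then_else_; _∧_)
open import Data.Fin using (Fin; zero; suc)
open import Data.List as List using (List; []; _∷_; _++_; _∷ʳ_)
open import Data.List.Membership.Propositional using (_∈_; _∉_)
open import Data.List.Relation.Unary.All using (All)
open import Data.List.Relation.Unary.Unique.Propositional using (Unique)
open import Data.Maybe using (Maybe; just; nothing)
open import Data.Nat using (ℕ; zero; suc; _≤_; _≥_)
open import Data.Product using (Σ; ∃; ∃-syntax; _×_; _,_; proj₁; proj₂)
open import Data.Sum using (_⊎_)
open import Data.Unit using (⊤)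
open import Data.Vec as Vec using (Vec; []; _∷_; lookup)
import Data.Vec.Relation.Unary.All as VecAll
import Data.Vec.Relation.Unary.Unique.Propositional as VecUnique
open import Function using (_∘_; _⇔_)
open import Relation.Binary using (DecidableEquality)
open import Relation.Binary.Construct.Closure.ReflexiveTransitive using (Star)
open import Relation.Binary.PropositionalEquality using (_≡_; _≢_; refl; _≗_)
open import Relation.Nullary using (¬_; Dec; yes; no; does; ¬?)
open import Relation.Unary using (Pred; _⊆_; _⊥_)

-- The set of labels is Name extended with the special label crash.
module CrashStop (Role Name Basic : Set) (_≟_ : DecidableEquality Role) where

  -- A label together with its payload; crash carries none.
  data Message : Set where
    crash : Message
    _⟨_⟩  : Name → Basic → Message

  -- nothing stands for the label crash
  label : Message → Maybe Name
  label crash     = nothing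
  label (ℓ ⟨ _ ⟩) = just ℓ

  crash? : (m : Message) → Dec (m ≡ crash)
  crash? crash     = yes refl
  crash? (_ ⟨ _ ⟩) = no λ ()

  data Status : Set where
    live crashed : Status

  -- n bounds the free type variables (de Bruijn).
  -- comm p q a ms Gs is p → q^a : {mᵢ.Gᵢ}; enroute p a q j ms Gs is
  -- p^a ⇝ q : j {mᵢ.Gᵢ}. The index set I is Fin (suc k), hence nonempty.
  data GType (n : ℕ) : Set where
    comm    : Role → Role → Status → ∀ {k} →
              Vec Message (suc k) → Vec (GType n) (suc k) → GType n
    enroute : Role → Status → Role → ∀ {k} → Fin (suc k) →
              Vec Message (suc k) → Vec (GType n) (suc k) → GType n
    μ_      : GType (suc n) → GType n
    var     : Fin n → GType n
    end     : GType n

  ext : ∀ {m n} → (Fin m → Fin n) → Fin (suc m) → Fin (suc n)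
  ext ρ zero    = zero
  ext ρ (suc x) = suc (ρ x)

  renG  : ∀ {m n} → (Fin m → Fin n) → GType m → GType n
  renGs : ∀ {m n k} → (Fin m → Fin n) → Vec (GType m) k → Vec (GType n) k
  renG ρ (comm p q a ms Gs)      = comm p q a ms (renGs ρ Gs)
  renG ρ (enroute p a q j ms Gs) = enroute p a q j ms (renGs ρ Gs)
  renG ρ (μ G)                   = μ (renG (ext ρ) G)
  renG ρ (var x)                 = var (ρ x)
  renG ρ end                     = end
  renGs ρ []       = []
  renGs ρ (G ∷ Gs) = renG ρ G ∷ renGs ρ Gs

  extsG : ∀ {m n} → (Fin m → GType n) → Fin (suc m) → GType (suc n)
  extsG σ zero    = var zero
  extsG σ (suc x) = renG suc (σ x)

  subG  : ∀ {m n} → (Fin m → GType n) → GType m → GType n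
  subGs : ∀ {m n k} → (Fin m → GType n) → Vec (GType m) k → Vec (GType n) k
  subG σ (comm p q a ms Gs)      = comm p q a ms (subGs σ Gs)
  subG σ (enroute p a q j ms Gs) = enroute p a q j ms (subGs σ Gs)
  subG σ (μ G)                   = μ (subG (extsG σ) G)
  subG σ (var x)                 = σ x
  subG σ end                     = end
  subGs σ []       = []
  subGs σ (G ∷ Gs) = subG σ G ∷ subGs σ Gs

  oneG : ∀ {n} → GType n → Fin (suc n) → GType n
  oneG G zero    = G
  oneG G (suc x) = var x

  -- G [μt.G / t]
  unfoldG : ∀ {n} → GType (suc n) → GType n
  unfoldG G = subG (oneG (μ G)) G

  -- Every occurrence of x lies under a communication.
  data GuardedG {n} (x : Fin n) : GType n → Set where
    comm    : ∀ {p q a k} {ms : Vec Message (suc k)} {Gs} →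
              GuardedG x (comm p q a ms Gs)
    enroute : ∀ {p a q k j} {ms : Vec Message (suc k)} {Gs} →
              GuardedG x (enroute p a q j ms Gs)
    μ_      : ∀ {G} → GuardedG (suc x) G → GuardedG x (μ G)
    var     : ∀ {y} → x ≢ y → GuardedG x (var y)
    end     : GuardedG x end

  record WFChoice {k} (p q : Role) (ms : Vec Message (suc k)) : Set where
    field
      distinct-roles  : p ≢ q
      distinct-labels : VecUnique.Unique (Vec.map label ms)
      not-only-crash  : ¬ VecAll.All (_≡ crash) ms

  data WFG {n} : GType n → Set where
    comm    : ∀ {p q a k} {ms : Vec Message (suc k)} {Gs} → WFChoice p q ms →
              (∀ i → WFG (lookup Gs i)) → WFG (comm p q a ms Gs)
    enroute : ∀ {p a q k j} {ms : Vec Message (suc k)} {Gs} → WFChoice p q ms →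
              (∀ i → WFG (lookup Gs i)) → WFG (enroute p a q j ms Gs)
    μ_      : ∀ {G} → GuardedG zero G → WFG G → WFG (μ G)
    var     : ∀ {x} → WFG (var x)
    end     : WFG end

  data RuntimeFree {n} : GType n → Set where
    comm : ∀ {p q k} {ms : Vec Message (suc k)} {Gs} →
           (∀ i → RuntimeFree (lookup Gs i)) → RuntimeFree (comm p q live ms Gs)
    μ_   : ∀ {G} → RuntimeFree G → RuntimeFree (μ G)
    var  : ∀ {x} → RuntimeFree (var x)
    end  : RuntimeFree end

  data Roles {n} : GType n → Pred Role 0ℓ where
    sender    : ∀ {p q a k} {ms : Vec Message (suc k)} {Gs} →
                Roles (comm p q a ms Gs) p
    receiver  : ∀ {p q k} {ms : Vec Message (suc k)} {Gs} →
                Roles (comm p q live ms Gs) q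
    branch    : ∀ {p q a k r} {ms : Vec Message (suc k)} {Gs} i →
                Roles (lookup Gs i) r → Roles (comm p q a ms Gs) r
    receiver⇝ : ∀ {p a q k j} {ms : Vec Message (suc k)} {Gs} →
                Roles (enroute p a q j ms Gs) q
    branch⇝   : ∀ {p a q k j r} {ms : Vec Message (suc k)} {Gs} i →
                Roles (lookup Gs i) r → Roles (enroute p a q j ms Gs) r
    unfold    : ∀ {G r} → Roles (unfoldG G) r → Roles (μ G) r

  -- The annotated sender of an en-route message is deliberately not counted.
  data Roles⊥ {n} : GType n → Pred Role 0ℓ where
    receiver : ∀ {p q k} {ms : Vec Message (suc k)} {Gs} →
               Roles⊥ (comm p q crashed ms Gs) q
    branch   : ∀ {p q a k r} {ms : Vec Message (suc k)} {Gs} i →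
               Roles⊥ (lookup Gs i) r → Roles⊥ (comm p q a ms Gs) r
    branch⇝  : ∀ {p a q k j r} {ms : Vec Message (suc k)} {Gs} i →
               Roles⊥ (lookup Gs i) r → Roles⊥ (enroute p a q j ms Gs) r
    unfold   : ∀ {G r} → Roles⊥ (unfoldG G) r → Roles⊥ (μ G) r

  -- Syntactic occurrence, annotated or not.
  data Occurs {n} (r : Role) : GType n → Set where
    comm     : ∀ {p q a k} {ms : Vec Message (suc k)} {Gs} →
               r ≡ p ⊎ r ≡ q → Occurs r (comm p q a ms Gs)
    branch   : ∀ {p q a k} {ms : Vec Message (suc k)} {Gs} i →
               Occurs r (lookup Gs i) → Occurs r (comm p q a ms Gs)
    enroute  : ∀ {p a q k j} {ms : Vec Message (suc k)} {Gs} →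
               r ≡ p ⊎ r ≡ q → Occurs r (enroute p a q j ms Gs)
    branch⇝  : ∀ {p a q k j} {ms : Vec Message (suc k)} {Gs} i →
               Occurs r (lookup Gs i) → Occurs r (enroute p a q j ms Gs)
    μ_       : ∀ {G} → Occurs r G → Occurs r (μ G)

  data FreeIn {n} (x : Fin n) : GType n → Set where
    branch  : ∀ {p q a k} {ms : Vec Message (suc k)} {Gs} i →
              FreeIn x (lookup Gs i) → FreeIn x (comm p q a ms Gs)
    branch⇝ : ∀ {p a q k j} {ms : Vec Message (suc k)} {Gs} i →
              FreeIn x (lookup Gs i) → FreeIn x (enroute p a q j ms Gs)
    μ_      : ∀ {G} → FreeIn (suc x) G → FreeIn x (μ G)
    var     : FreeIn x (var x)

  data LType (n : ℕ) : Set where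
    recv send : Role → List (Message × LType n) → LType n
    μ_        : LType (suc n) → LType n
    var       : Fin n → LType n
    end stop  : LType n

  Branches : ℕ → Set
  Branches n = List (Message × LType n)

  labels : ∀ {n} → Branches n → List (Maybe Name)
  labels = List.map (label ∘ proj₁)

  renL  : ∀ {m n} → (Fin m → Fin n) → LType m → LType n
  renLs : ∀ {m n} → (Fin m → Fin n) → Branches m → Branches n
  renL ρ (recv p bs) = recv p (renLs ρ bs)
  renL ρ (send p bs) = send p (renLs ρ bs)
  renL ρ (μ T)       = μ (renL (ext ρ) T)
  renL ρ (var x)     = var (ρ x)
  renL ρ end         = end
  renL ρ stop        = stop
  renLs ρ []             = []
  renLs ρ ((m , T) ∷ bs) = (m , renL ρ T) ∷ renLs ρ bs

  extsL : ∀ {m n} → (Fin m → LType n) → Fin (suc m) → LType (suc n)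
  extsL σ zero    = var zero
  extsL σ (suc x) = renL suc (σ x)

  subL  : ∀ {m n} → (Fin m → LType n) → LType m → LType n
  subLs : ∀ {m n} → (Fin m → LType n) → Branches m → Branches n
  subL σ (recv p bs) = recv p (subLs σ bs)
  subL σ (send p bs) = send p (subLs σ bs)
  subL σ (μ T)       = μ (subL (extsL σ) T)
  subL σ (var x)     = σ x
  subL σ end         = end
  subL σ stop        = stop
  subLs σ []             = []
  subLs σ ((m , T) ∷ bs) = (m , subL σ T) ∷ subLs σ bs

  oneL : ∀ {n} → LType n → Fin (suc n) → LType n
  oneL T zero    = T
  oneL T (suc x) = var x

  -- T [μt.T / t]
  unfoldL : ∀ {n} → LType (suc n) → LType n
  unfoldL T = subL (oneL (μ T)) T

  -- As GuardedG, but with no rule for end and stop, so that vacuous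
  -- recursions such as μt.end are not contractive local types. They are
  -- behaviourally inert yet syntactically different from end: with
  -- q⊕{a.μt.end} ⩽ q⊕{a.end}, a reliable role could get stuck at μt.end.
  data GuardedL {n} (x : Fin n) : LType n → Set where
    recv : ∀ {p bs} → GuardedL x (recv p bs)
    send : ∀ {p bs} → GuardedL x (send p bs)
    μ_   : ∀ {T} → GuardedL (suc x) T → GuardedL x (μ T)
    var  : ∀ {y} → x ≢ y → GuardedL x (var y)

  data WFL {n} : LType n → Set where
    recv : ∀ {p bs} → bs ≢ [] → Unique (labels bs) →
           ¬ All ((_≡ crash) ∘ proj₁) bs →
           (∀ {m T} → (m , T) ∈ bs → WFL T) → WFL (recv p bs)
    send : ∀ {p bs} → bs ≢ [] → Unique (labels bs) →
           All ((_≢ crash) ∘ proj₁) bs →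
           (∀ {m T} → (m , T) ∈ bs → WFL T) → WFL (send p bs)
    μ_   : ∀ {T} → GuardedL zero T → WFL T → WFL (μ T)
    var  : ∀ {x} → WFL (var x)
    end  : WFL end
    stop : WFL stop

  -- Merge, as the graph of a partial operation: S ⊓ T ≈ U

  mutual
    data _⊓_≈_ {n} : LType n → LType n → LType n → Set where
      recv : ∀ {p bs cs ds} → MergeExt bs cs ds → recv p bs ⊓ recv p cs ≈ recv p ds
      send : ∀ {p bs cs ds} → MergeInt bs cs ds → send p bs ⊓ send p cs ≈ send p ds
      μ_   : ∀ {S T U} → S ⊓ T ≈ U → (μ S) ⊓ (μ T) ≈ (μ U)
      var  : ∀ {x} → var x ⊓ var x ≈ var x
      end  : end ⊓ end ≈ end

    -- Walk through the left-hand branches, removing from the right-hand ones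
    -- those with a common label; what remains on the right is kept.
    -- A common label with two different payloads makes the merge undefined.
    data MergeExt {n} : Branches n → Branches n → Branches n → Set where
      rest : ∀ {cs} → MergeExt [] cs cs
      both : ∀ {m S T U bs cs₁ cs₂ ds} → S ⊓ T ≈ U → MergeExt bs (cs₁ ++ cs₂) ds →
             MergeExt ((m , S) ∷ bs) (cs₁ ++ (m , T) ∷ cs₂) ((m , U) ∷ ds)
      left : ∀ {m S bs cs ds} → label m ∉ labels cs → MergeExt bs cs ds →
             MergeExt ((m , S) ∷ bs) cs ((m , S) ∷ ds)

    data MergeInt {n} : Branches n → Branches n → Branches n → Set where
      done : MergeInt [] [] []
      both : ∀ {m S T U bs cs₁ cs₂ ds} → S ⊓ T ≈ U → MergeInt bs (cs₁ ++ cs₂) ds →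
             MergeInt ((m , S) ∷ bs) (cs₁ ++ (m , T) ∷ cs₂) ((m , U) ∷ ds)

  data ⨅_≈_ {n} : ∀ {k} → Vec (LType n) (suc k) → LType n → Set where
    one  : ∀ {T} → ⨅ (T ∷ []) ≈ T
    more : ∀ {k T U V} {Ts : Vec (LType n) (suc k)} →
           ⨅ Ts ≈ U → T ⊓ U ≈ V → ⨅ (T ∷ Ts) ≈ V

  -- Projection, as the graph of a partial operation: G ↾[ R ] p ≈ T

  branches : ∀ {n k} → Vec Message k → Vec (LType n) k → Branches n
  branches ms Ts = Vec.toList (Vec.zip ms Ts)

  dropCrash : ∀ {n} → Branches n → Branches n
  dropCrash = List.filter (¬? ∘ crash? ∘ proj₁)

  CrashHandled : Pred Role 0ℓ → Role → ∀ {k} → Vec Message k → Set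
  CrashHandled R q ms = ¬ R q → ∃[ i ] lookup ms i ≡ crash

  data Projects (R : Pred Role 0ℓ) {n} : GType n → Role → LType n → Set

  syntax Projects R G p T = G ↾[ R ] p ≈ T

  data Projects R {n} where
    -- Entries of Ts at crash positions are arbitrary; they are dropped.
    send    : ∀ {p r a k} {ms : Vec Message (suc k)} {Gs Ts} →
              (∀ i → lookup ms i ≢ crash → lookup Gs i ↾[ R ] p ≈ lookup Ts i) →
              comm p r a ms Gs ↾[ R ] p ≈ send r (dropCrash (branches ms Ts))
    recv    : ∀ {q p a k} {ms : Vec Message (suc k)} {Gs Ts} →
              CrashHandled R q ms →
              (∀ i → lookup Gs i ↾[ R ] p ≈ lookup Ts i) →
              comm q p a ms Gs ↾[ R ] p ≈ recv q (branches ms Ts)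
    other   : ∀ {q r a p k T} {ms : Vec Message (suc k)} {Gs Ts} →
              p ≢ q → p ≢ r →
              (∀ i → lookup Gs i ↾[ R ] p ≈ lookup Ts i) → ⨅ Ts ≈ T →
              comm q r a ms Gs ↾[ R ] p ≈ T
    send⇝   : ∀ {p a r k j T} {ms : Vec Message (suc k)} {Gs} →
              lookup Gs j ↾[ R ] p ≈ T →
              enroute p a r j ms Gs ↾[ R ] p ≈ T
    recv⇝   : ∀ {q a p k j} {ms : Vec Message (suc k)} {Gs Ts} →
              CrashHandled R q ms →
              (∀ i → lookup Gs i ↾[ R ] p ≈ lookup Ts i) →
              enroute q a p j ms Gs ↾[ R ] p ≈ recv q (branches ms Ts)
    other⇝  : ∀ {q a r p k j T} {ms : Vec Message (suc k)} {Gs Ts} →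
              p ≢ q → p ≢ r →
              (∀ i → lookup Gs i ↾[ R ] p ≈ lookup Ts i) → ⨅ Ts ≈ T →
              enroute q a r j ms Gs ↾[ R ] p ≈ T
    rec     : ∀ {p G T} → Occurs p G ⊎ (∃[ x ] FreeIn x (μ G)) →
              G ↾[ R ] p ≈ T → (μ G) ↾[ R ] p ≈ (μ T)
    rec-end : ∀ {p G} → ¬ (Occurs p G ⊎ (∃[ x ] FreeIn x (μ G))) →
              (μ G) ↾[ R ] p ≈ end
    var     : ∀ {p x} → var x ↾[ R ] p ≈ var x
    end     : ∀ {p} → end ↾[ R ] p ≈ end

  data SubRule (_≲_ : LType 0 → LType 0 → Set) : LType 0 → LType 0 → Set where
    end     : SubRule _≲_ end end
    stop    : SubRule _≲_ stop stop
    -- The last premise says that no branch outside I is a crash branch.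
    recv    : ∀ {p bs cs} →
              (∀ {m T′} → (m , T′) ∈ cs → ∃[ T ] (m , T) ∈ bs × T ≲ T′) →
              ¬ All ((_≡ crash) ∘ proj₁) cs →
              (nothing ∈ labels bs → nothing ∈ labels cs) →
              SubRule _≲_ (recv p bs) (recv p cs)
    send    : ∀ {p bs cs} →
              (∀ {m T} → (m , T) ∈ bs → ∃[ T′ ] (m , T′) ∈ cs × T ≲ T′) →
              SubRule _≲_ (send p bs) (send p cs)
    unfoldˡ : ∀ {T T′} → unfoldL T ≲ T′ → SubRule _≲_ (μ T) T′
    unfoldʳ : ∀ {T T′} → T ≲ unfoldL T′ → SubRule _≲_ T (μ T′)

  -- The coinductive reading: the union of all relations that are backward
  -- closed under the rules.
  _⩽_ : LType 0 → LType 0 → Set₁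
  S ⩽ T = Σ (LType 0 → LType 0 → Set) λ _≲_ →
            (∀ {S′ T′} → S′ ≲ T′ → SubRule _≲_ S′ T′) × S ≲ T

  Ctx : Set
  Ctx = Role → Maybe (LType 0)

  data Queue : Set where
    avail : List Message → Queue
    ⊘     : Queue

  pattern ε = avail []

  _·_ : Queue → Message → Queue
  avail τ · m = avail (τ ∷ʳ m)
  ⊘       · m = ⊘

  QEnv : Set
  QEnv = Role → Role → Queue

  Config : Set
  Config = Ctx × QEnv

  Δε : QEnv
  Δε _ _ = ε

  WFCtx : Ctx → Set
  WFCtx Γ = ∀ {p T} → Γ p ≡ just T → WFL T

  dom : Ctx → Pred Role 0ℓ
  dom Γ p = ∃[ T ] Γ p ≡ just T

  infixl 8 _[_↦_] _[_⇒_↦_] _[·,_↦⊘]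

  _[_↦_] : Ctx → Role → LType 0 → Ctx
  (Γ [ p ↦ T ]) r = if does (r ≟ p) then just T else Γ r

  _[_⇒_↦_] : QEnv → Role → Role → Queue → QEnv
  (Δ [ p ⇒ q ↦ τ ]) r s = if does (r ≟ p) ∧ does (s ≟ q) then τ else Δ r s

  _[·,_↦⊘] : QEnv → Role → QEnv
  (Δ [·, q ↦⊘]) r s = if does (s ≟ q) then ⊘ else Δ r s

  -- Configurations are maps, so they are compared pointwise.
  _≈ᶜ_ : Config → Config → Set
  (Γ , Δ) ≈ᶜ (Γ′ , Δ′) = Γ ≗ Γ′ × (∀ p → Δ p ≗ Δ′ p)

  data Action : Set where
    _&_∶_ _⊕_∶_ : Role → Role → Message → Action
    cr          : Role → Action
    det         : Role → Role → Action

  data _—[_]→_ : Config → Action → Config → Set where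
    send    : ∀ {Γ Δ p q bs m T c} →
              Γ p ≡ just (send q bs) → (m , T) ∈ bs →
              c ≈ᶜ (Γ [ p ↦ T ] , Δ [ p ⇒ q ↦ Δ p q · m ]) →
              (Γ , Δ) —[ p ⊕ q ∶ m ]→ c
    receive : ∀ {Γ Δ p q bs m T τ c} →
              Γ p ≡ just (recv q bs) → (m , T) ∈ bs → Δ q p ≡ avail (m ∷ τ) →
              c ≈ᶜ (Γ [ p ↦ T ] , Δ [ q ⇒ p ↦ avail τ ]) →
              (Γ , Δ) —[ p & q ∶ m ]→ c
    rec     : ∀ {Γ Δ p T α c} →
              Γ p ≡ just (μ T) → (Γ [ p ↦ unfoldL T ] , Δ) —[ α ]→ c →
              (Γ , Δ) —[ α ]→ c
    crash   : ∀ {Γ Δ p T c} →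
              Γ p ≡ just T → T ≢ end → T ≢ stop →
              c ≈ᶜ (Γ [ p ↦ stop ] , Δ [·, p ↦⊘]) →
              (Γ , Δ) —[ cr p ]→ c
    detect  : ∀ {Γ Δ p q bs T c} →
              Γ q ≡ just (recv p bs) → Γ p ≡ just stop →
              (crash , T) ∈ bs → Δ p q ≡ ε →
              c ≈ᶜ (Γ [ q ↦ T ] , Δ) →
              (Γ , Δ) —[ det q p ]→ c

  Enabled : Config → Action → Set
  Enabled c α = ∃[ c′ ] c —[ α ]→ c′

  _⟶_ : Config → Config → Set
  c ⟶ c′ = ∃[ α ] (∀ r → α ≢ cr r) × c —[ α ]→ c′

  _⟶[_]_ : Config → Pred Role 0ℓ → Config → Set
  c ⟶[ R ] c′ = ∃[ α ] (∀ r → R r → α ≢ cr r) × c —[ α ]→ c′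

  _⟶*[_]_ : Config → Pred Role 0ℓ → Config → Set
  c ⟶*[ R ] c′ = Star _⟶[ R ]_ c c′

  record WellAnnotated (R C : Pred Role 0ℓ) (G : GType 0) : Set where
    field
      ⊥-unreliable : Roles⊥ G ⊥ R
      ⊥-crashed    : Roles⊥ G ⊆ C
      ⊥-not-live   : Roles G ⊥ Roles⊥ G

  -- Γ is the union of Γ₁, Γ₂, Γ₃, whose domains are pairwise disjoint.
  Splits : Ctx → Ctx → Ctx → Ctx → Set
  Splits Γ Γ₁ Γ₂ Γ₃ = ∀ p →
      (Γ₁ p ≡ Γ p     × Γ₂ p ≡ nothing × Γ₃ p ≡ nothing)
    ⊎ (Γ₁ p ≡ nothing × Γ₂ p ≡ Γ p     × Γ₃ p ≡ nothing)
    ⊎ (Γ₁ p ≡ nothing × Γ₂ p ≡ nothing × Γ₃ p ≡ Γ p)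

  record CtxAssociated (R : Pred Role 0ℓ) (Γ : Ctx) (C : Pred Role 0ℓ)
                       (G : GType 0) : Set₁ where
    field
      ΓG Γstop Γend : Ctx
      splits     : Splits Γ ΓG Γstop Γend
      dom-ΓG     : ∀ p → dom ΓG p ⇔ Roles G p
      subtype    : ∀ {p S} → ΓG p ≡ just S → ∃[ T ] (G ↾[ R ] p ≈ T) × S ⩽ T
      dom-Γstop  : ∀ p → dom Γstop p ⇔ C p
      stopped    : ∀ {p S} → Γstop p ≡ just S → S ≡ stop
      ended      : ∀ {p S} → Γend p ≡ just S → S ≡ end

  Unavailable : Pred Role 0ℓ → QEnv → Set
  Unavailable C Δ = ∀ q → C q ⇔ (∀ p → Δ p q ≡ ⊘)

  data QAssociated (C : Pred Role 0ℓ) (Δ : QEnv) : GType 0 → Set where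
    end      : Unavailable C Δ → (∀ p q → ¬ C q → Δ p q ≡ ε) →
               QAssociated C Δ end
    μ_       : ∀ {G} → Unavailable C Δ → (∀ p q → ¬ C q → Δ p q ≡ ε) →
               QAssociated C Δ (μ G)
    comm     : ∀ {p q a k} {ms : Vec Message (suc k)} {Gs} → Unavailable C Δ →
               (a ≡ live → Δ p q ≡ ε) →
               (∀ i → QAssociated C Δ (lookup Gs i)) →
               QAssociated C Δ (comm p q a ms Gs)
    crashed⇝ : ∀ {p a q k j} {ms : Vec Message (suc k)} {Gs} → Unavailable C Δ →
               lookup ms j ≡ crash → Δ p q ≡ ε →
               (∀ i → QAssociated C Δ (lookup Gs i)) →
               QAssociated C Δ (enroute p a q j ms Gs)
    sent⇝    : ∀ {p a q k j τ} {ms : Vec Message (suc k)} {Gs} → Unavailable C Δ →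
               lookup ms j ≢ crash → Δ p q ≡ avail (lookup ms j ∷ τ) →
               (∀ i → QAssociated C (Δ [ p ⇒ q ↦ avail τ ]) (lookup Gs i)) →
               QAssociated C Δ (enroute p a q j ms Gs)

  record Associated (R : Pred Role 0ℓ) (c : Config) (C : Pred Role 0ℓ)
                    (G : GType 0) : Set₁ where
    field
      well-annotated : WellAnnotated R C G
      context        : CtxAssociated R (proj₁ c) C G
      queues         : QAssociated C (proj₂ c) G

  record SafetyProperty (R : Pred Role 0ℓ) (φ : Pred Config 0ℓ) : Set where
    field
      S1 : ∀ {Γ Δ p q bs} → φ (Γ , Δ) → Γ q ≡ just (recv p bs) →
           Δ p q ≢ ⊘ → Δ p q ≢ ε → ∃[ m ] Enabled (Γ , Δ) (q & p ∶ m)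
      S2 : ∀ {Γ Δ p q bs} → φ (Γ , Δ) → Γ p ≡ just stop →
           Γ q ≡ just (recv p bs) → Δ p q ≡ ε → Enabled (Γ , Δ) (det q p)
      S3 : ∀ {Γ Δ p T} → φ (Γ , Δ) → Γ p ≡ just (μ T) →
           φ (Γ [ p ↦ unfoldL T ] , Δ)
      S4 : ∀ {c c′} → φ c → c ⟶[ R ] c′ → φ c′

  Safe : Pred Role 0ℓ → Config → Set₁
  Safe R c = Σ (Pred Config 0ℓ) λ φ → SafetyProperty R φ × φ c

  Terminated : Config → Set
  Terminated (Γ , Δ) =
      (∀ {p T} → Γ p ≡ just T → T ≡ end ⊎ T ≡ stop)
    × (∀ q → Γ q ≡ just stop → ∀ p → Δ p q ≡ ⊘)
    × (∀ p q → Γ q ≢ just stop → Δ p q ≡ ε)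

  DeadlockFree : Pred Role 0ℓ → Config → Set₁
  DeadlockFree R c = Safe R c ×
    (∀ c′ → c ⟶*[ R ] c′ → ¬ (∃[ c″ ] c′ ⟶[ R ] c″) → Terminated c′)

  -- The index set N: upTo l is {0,…,l} and all is ℕ.
  data Extent : Set where
    upTo : ℕ → Extent
    all  : Extent

  _∈ᴺ_ : ℕ → Extent → Set
  n ∈ᴺ upTo l = n ≤ l
  n ∈ᴺ all    = ⊤

  record Path : Set where
    field
      N    : Extent
      conf : ℕ → Config      -- only its values on N matter
      step : ∀ n → suc n ∈ᴺ N → conf n ⟶ conf (suc n)

  module _ (π : Path) where
    open Path π

    Γ-at : ℕ → Ctx
    Γ-at n = proj₁ (conf n)

    Δ-at : ℕ → QEnv
    Δ-at n = proj₂ (conf n)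

    Fires : ℕ → Action → Set
    Fires k α = suc k ∈ᴺ N × conf k —[ α ]→ conf (suc k)

    record FairPath : Set where
      field
        F1 : ∀ n → n ∈ᴺ N → ∀ {p q m} → Enabled (conf n) (p ⊕ q ∶ m) →
             ∃[ k ] k ≥ n × ∃[ m′ ] Fires k (p ⊕ q ∶ m′)
        F2 : ∀ n → n ∈ᴺ N → ∀ {p q m} → Enabled (conf n) (p & q ∶ m) →
             ∃[ k ] k ≥ n × Fires k (p & q ∶ m)
        F3 : ∀ n → n ∈ᴺ N → ∀ {p q} → Enabled (conf n) (det p q) →
             ∃[ k ] k ≥ n × Fires k (det p q)

    record LivePath : Set where
      field
        L1 : ∀ n → n ∈ᴺ N → ∀ {p q m τ} → Δ-at n p q ≡ avail (m ∷ τ) → m ≢ crash →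
             ∃[ k ] k ≥ n × Fires k (q & p ∶ m)
        L2 : ∀ n → n ∈ᴺ N → ∀ {p q bs} → Γ-at n p ≡ just (recv q bs) →
             ∃[ k ] k ≥ n × ((∃[ m′ ] Fires k (p & q ∶ m′)) ⊎ Fires k (det p q))

  Live : Pred Role 0ℓ → Config → Set₁
  Live R c = Safe R c ×
    (∀ c′ → c ⟶*[ R ] c′ → (π : Path) → Path.conf π 0 ≈ᶜ c′ → FairPath π → LivePath π)

module Submission where

-- The global type is executed lazily: only the part of it that some action has
-- reached is unrolled, into a finite tree in which a communication that has
-- been started keeps its chosen branch only. A role sends, receives or detects
-- below communications in which it takes no part, at the same time in all their
-- branches; crashes do not change the tree. The invariant is that every role
-- is either stopped, or has a type that follows the tree and incoming queues
-- that hold what the tree has in transit. Projection and merging enter only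
-- through Proj, which is closed under unfolding and under passing to branches.
-- The root of the tree always has an enabled action, unless the roles that
-- could perform it are stopped and the root can be dropped. This gives
-- deadlock-freedom. A fair path performs the root action eventually, and then
-- every communication below comes closer to the root, which gives liveness.

open import Defs
open import Level using (0ℓ)
open import Data.Empty using (⊥-elim)
open import Data.Fin using (Fin; zero; suc)
open import Data.List using (List; []; _∷_; _++_; _∷ʳ_)
open import Data.List.Membership.Propositional using (_∈_)
open import Data.List.Membership.Propositional.Properties using (∈-filter⁻; ∈-map⁺; ∈-++⁺ʳ)
open import Data.List.Relation.Unary.Any using (here; there)
import Data.List.Relation.Unary.All as All
import Data.List.Relation.Unary.AllPairs as AllPairs
open import Data.List.Relation.Unary.Unique.Propositional using (Unique)
open import Data.Maybe using (just; nothing)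
open import Data.Nat using (ℕ; zero; suc; _+_; _≤_; _<_; _≥_; _⊔_; s≤s; _≤′_; ≤′-refl; ≤′-step)
open import Data.Nat.Properties
  using (≤-refl; ≤-trans; m≤n⇒∃[o]m+o≡n; +-comm; n≤1+n; m≤m⊔n; m≤n⊔m; n<1+n; ≤⇒≤′; +-suc; m≤n+m)
open import Data.Nat.Induction using (<-wellFounded)
open import Data.Product using (∃-syntax; _×_; _,_; proj₁; proj₂)
open import Data.Sum using (_⊎_; inj₁; inj₂)
open import Data.Unit using (⊤; tt)
open import Data.Vec using (Vec; []; _∷_; lookup)
open import Function using (_∘_; Equivalence)
open import Induction.WellFounded using (Acc; acc)
open import Relation.Binary using (DecidableEquality)
open import Relation.Binary.Construct.Closure.ReflexiveTransitive using (Star; _◅_; _◅◅_)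
  renaming (ε to ε*)
open import Relation.Binary.PropositionalEquality
  using (_≡_; _≢_; refl; sym; trans; cong; subst; subst₂)
open import Relation.Nullary using (¬_; Dec; yes; no; contradiction; ¬?)
open import Relation.Unary using (Pred; ∅)

-- The difficulty lies in actions away from the root. A role may act below communications of others
-- that have not started, and behind recursions, and the branches may need different numbers of
-- unfoldings before its communication appears. That finitely many suffice comes from projection: a
-- role keeps one type across all branches of a communication it takes no part in, so a
-- communication at the head of that type must be introduced on every path, at bounded depth.
-- Subtyping and merging are kept apart. A merge may add a crash branch, which subtyping forbids in
-- the smaller type; so `Proj` absorbs the merges, and one use of `⩽` remains at each leaf, between
-- head normal forms. Head normal forms also hide the unfoldings that the reduction rule `rec`
-- performs on the way to an action. Recording a crash in the tree would change parts that are not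
-- yet unrolled. A crashed role is instead released from following the tree, and nodes that become
-- stale in this way stay until they stand at the root.

module Development (Role Name Basic : Set) (_≟_ : DecidableEquality Role)
                   (R : Pred Role 0ℓ) where

  open CrashStop Role Name Basic _≟_

  private variable
    m n k d : ℕ

  -- Lookup and membership under renaming and substitution

  lookup-renGs : (ρ : Fin m → Fin n) (Gs : Vec (GType m) k) (i : Fin k) →
                 lookup (renGs ρ Gs) i ≡ renG ρ (lookup Gs i)
  lookup-renGs ρ (G ∷ Gs) zero    = refl
  lookup-renGs ρ (G ∷ Gs) (suc i) = lookup-renGs ρ Gs i

  lookup-subGs : (σ : Fin m → GType n) (Gs : Vec (GType m) k) (i : Fin k) →
                 lookup (subGs σ Gs) i ≡ subG σ (lookup Gs i)
  lookup-subGs σ (G ∷ Gs) zero    = refl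
  lookup-subGs σ (G ∷ Gs) (suc i) = lookup-subGs σ Gs i

  ∈-renLs⁺ : ∀ {ρ : Fin m → Fin n} {a T bs} → (a , T) ∈ bs → (a , renL ρ T) ∈ renLs ρ bs
  ∈-renLs⁺ (here refl)                    = here refl
  ∈-renLs⁺ {bs = (_ , _) ∷ _} (there a∈bs) = there (∈-renLs⁺ a∈bs)

  ∈-renLs⁻ : ∀ {ρ : Fin m → Fin n} {a T} bs → (a , T) ∈ renLs ρ bs →
             ∃[ S ] (a , S) ∈ bs × T ≡ renL ρ S
  ∈-renLs⁻ ((_ , _) ∷ bs) (here refl) = _ , here refl , refl
  ∈-renLs⁻ ((_ , _) ∷ bs) (there a∈)  =
    let S , S∈ , eq = ∈-renLs⁻ bs a∈ in S , there S∈ , eq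

  ∈-subLs⁺ : ∀ {σ : Fin m → LType n} {a T bs} → (a , T) ∈ bs → (a , subL σ T) ∈ subLs σ bs
  ∈-subLs⁺ (here refl)                    = here refl
  ∈-subLs⁺ {bs = (_ , _) ∷ _} (there a∈bs) = there (∈-subLs⁺ a∈bs)

  ∈-subLs⁻ : ∀ {σ : Fin m → LType n} {a T} bs → (a , T) ∈ subLs σ bs →
             ∃[ S ] (a , S) ∈ bs × T ≡ subL σ S
  ∈-subLs⁻ ((_ , _) ∷ bs) (here refl) = _ , here refl , refl
  ∈-subLs⁻ ((_ , _) ∷ bs) (there a∈)  =
    let S , S∈ , eq = ∈-subLs⁻ bs a∈ in S , there S∈ , eq

  -- Contractive local types and their head normal forms

  data Headed {n} : ℕ → LType n → Set where
    recv : ∀ {p bs} → Headed zero (recv p bs)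
    send : ∀ {p bs} → Headed zero (send p bs)
    μ_   : ∀ {T} → Headed d T → Headed (suc d) (μ T)

  data HeadVar {n} (x : Fin n) : LType n → Set where
    var : HeadVar x (var x)
    μ_  : ∀ {T} → HeadVar (suc x) T → HeadVar x (μ T)

  IsHeaded : LType n → Set
  IsHeaded T = ∃[ d ] Headed d T

  -- The positive reading of guardedness: the leading binders end in a communication or in a
  -- variable bound further out, never in `end`, `stop` or the variable of this recursion. In this
  -- form it is transported along substitutions.
  Contractive : LType (suc n) → Set
  Contractive T = IsHeaded T ⊎ (∃[ x ] HeadVar (suc x) T)

  Headed-ren : ∀ {ρ : Fin m → Fin n} {T} → Headed d T → Headed d (renL ρ T)
  Headed-ren recv  = recv
  Headed-ren send  = send
  Headed-ren (μ h) = μ Headed-ren h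

  Headed-sub : ∀ {σ : Fin m → LType n} {T} → Headed d T → Headed d (subL σ T)
  Headed-sub recv  = recv
  Headed-sub send  = send
  Headed-sub (μ h) = μ Headed-sub h

  HeadVar-ren : ∀ {ρ : Fin m → Fin n} {x T} → HeadVar x T → HeadVar (ρ x) (renL ρ T)
  HeadVar-ren var   = var
  HeadVar-ren (μ h) = μ HeadVar-ren h

  HeadVar-sub-Headed : ∀ {σ : Fin m → LType n} {x T} → HeadVar x T → Headed d (σ x) →
                       IsHeaded (subL σ T)
  HeadVar-sub-Headed var   h = _ , h
  HeadVar-sub-Headed (μ v) h = let e , h′ = HeadVar-sub-Headed v (Headed-ren h) in suc e , μ h′

  HeadVar-sub-HeadVar : ∀ {σ : Fin m → LType n} {x y T} → HeadVar x T → σ x ≡ var y →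
                        HeadVar y (subL σ T)
  HeadVar-sub-HeadVar var   eq rewrite eq = var
  HeadVar-sub-HeadVar (μ v) eq = μ HeadVar-sub-HeadVar v (cong (renL suc) eq)

  -- What a substitution has to supply for contractivity to survive: putting `end` for an outer head
  -- variable would destroy it.
  HeadedOrVar : LType n → Set
  HeadedOrVar T = IsHeaded T ⊎ (∃[ x ] T ≡ var x)

  extsL-HeadedOrVar : ∀ {σ : Fin m → LType n} → (∀ x → HeadedOrVar (σ x)) →
                      ∀ x → HeadedOrVar (extsL σ x)
  extsL-HeadedOrVar hσ zero    = inj₂ (zero , refl)
  extsL-HeadedOrVar hσ (suc x) with hσ x
  ... | inj₁ (d , h)  = inj₁ (d , Headed-ren h)
  ... | inj₂ (y , eq) = inj₂ (suc y , cong (renL suc) eq)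

  Contractive-ren : ∀ {ρ : Fin m → Fin n} {T} → Contractive T → Contractive (renL (ext ρ) T)
  Contractive-ren (inj₁ (d , h)) = inj₁ (d , Headed-ren h)
  Contractive-ren (inj₂ (x , h)) = inj₂ (_ , HeadVar-ren h)

  Contractive-sub : ∀ {σ : Fin m → LType n} {T} → (∀ x → HeadedOrVar (σ x)) →
                    Contractive T → Contractive (subL (extsL σ) T)
  Contractive-sub hσ (inj₁ (d , h)) = inj₁ (d , Headed-sub h)
  Contractive-sub hσ (inj₂ (x , v)) with hσ x
  ... | inj₁ (d , h)  = inj₁ (HeadVar-sub-Headed v (Headed-ren h))
  ... | inj₂ (y , eq) = inj₂ (y , HeadVar-sub-HeadVar v (cong (renL suc) eq))

  Contractive-closed : ∀ {T : LType 1} → Contractive T → IsHeaded T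
  Contractive-closed (inj₁ h)        = h
  Contractive-closed (inj₂ (() , _))

  -- Functional external choices make the continuation of a reception unique, nonempty internal
  -- choices can always send, and contractivity yields a head normal form. All three are stable
  -- under substitution.
  data Valid {n} : LType n → Set where
    recv : ∀ {p bs} → (∀ {a S T} → (a , S) ∈ bs → (a , T) ∈ bs → S ≡ T) →
           (∀ {a T} → (a , T) ∈ bs → Valid T) → Valid (recv p bs)
    send : ∀ {p bs a S} → (a , S) ∈ bs →
           (∀ {a T} → (a , T) ∈ bs → Valid T) → Valid (send p bs)
    μ_   : ∀ {T} → Contractive T → Valid T → Valid (μ T)
    var  : ∀ {x} → Valid (var x)
    end  : Valid end
    stop : Valid stop

  Valid-ren : ∀ {ρ : Fin m → Fin n} {T} → Valid T → Valid (renL ρ T)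
  Valid-ren (recv {bs = bs} fun v) = recv
    (λ S∈ T∈ → let S , S∈′ , eqS = ∈-renLs⁻ bs S∈
                   T , T∈′ , eqT = ∈-renLs⁻ bs T∈
               in trans eqS (trans (cong (renL _) (fun S∈′ T∈′)) (sym eqT)))
    (λ T∈ → let T , T∈′ , eq = ∈-renLs⁻ bs T∈ in subst Valid (sym eq) (Valid-ren (v T∈′)))
  Valid-ren (send {bs = bs} S∈ v) = send (∈-renLs⁺ S∈)
    (λ T∈ → let T , T∈′ , eq = ∈-renLs⁻ bs T∈ in subst Valid (sym eq) (Valid-ren (v T∈′)))
  Valid-ren ((μ c) v) = (μ Contractive-ren c) (Valid-ren v)
  Valid-ren var  = var
  Valid-ren end  = end
  Valid-ren stop = stop

  extsL-Valid : ∀ {σ : Fin m → LType n} → (∀ x → Valid (σ x)) → ∀ x → Valid (extsL σ x)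
  extsL-Valid vσ zero    = var
  extsL-Valid vσ (suc x) = Valid-ren (vσ x)

  Valid-sub : ∀ {σ : Fin m → LType n} {T} → (∀ x → HeadedOrVar (σ x)) → (∀ x → Valid (σ x)) →
              Valid T → Valid (subL σ T)
  Valid-sub hσ vσ (recv {bs = bs} fun v) = recv
    (λ S∈ T∈ → let S , S∈′ , eqS = ∈-subLs⁻ bs S∈
                   T , T∈′ , eqT = ∈-subLs⁻ bs T∈
               in trans eqS (trans (cong (subL _) (fun S∈′ T∈′)) (sym eqT)))
    (λ T∈ → let T , T∈′ , eq = ∈-subLs⁻ bs T∈ in subst Valid (sym eq) (Valid-sub hσ vσ (v T∈′)))
  Valid-sub hσ vσ (send {bs = bs} S∈ v) = send (∈-subLs⁺ S∈)
    (λ T∈ → let T , T∈′ , eq = ∈-subLs⁻ bs T∈ in subst Valid (sym eq) (Valid-sub hσ vσ (v T∈′)))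
  Valid-sub hσ vσ ((μ c) v) =
    (μ Contractive-sub hσ c) (Valid-sub (extsL-HeadedOrVar hσ) (extsL-Valid vσ) v)
  Valid-sub hσ vσ (var {x}) = vσ x
  Valid-sub hσ vσ end  = end
  Valid-sub hσ vσ stop = stop

  oneL-HeadedOrVar : ∀ {T : LType n} → Headed d T → ∀ x → HeadedOrVar (oneL T x)
  oneL-HeadedOrVar h zero    = inj₁ (_ , h)
  oneL-HeadedOrVar h (suc x) = inj₂ (x , refl)

  Valid-unfold : ∀ {T : LType 1} → Valid (μ T) → Valid (unfoldL T)
  Valid-unfold v@((μ c) v′) =
    Valid-sub (oneL-HeadedOrVar (μ proj₂ (Contractive-closed c)))
              (λ { zero → v ; (suc ()) }) v′

  HeadVar⇒¬GuardedL : ∀ {x : Fin n} {T} → HeadVar x T → ¬ GuardedL x T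
  HeadVar⇒¬GuardedL var   (var x≢x) = x≢x refl
  HeadVar⇒¬GuardedL (μ v) (μ g)     = HeadVar⇒¬GuardedL v g

  -- The third alternative covers `end` and `stop`, for which `GuardedL` has no rule; guardedness of
  -- the bound variable then leaves exactly the two cases of `Contractive`.
  WFL-head : ∀ {T : LType n} → WFL T →
             IsHeaded T ⊎ (∃[ x ] HeadVar x T) ⊎ (∀ x → ¬ GuardedL x T)
  WFL-contractive : ∀ {T : LType (suc n)} → WFL T → GuardedL zero T → Contractive T
  WFL-head (recv _ _ _ _) = inj₁ (_ , recv)
  WFL-head (send _ _ _ _) = inj₁ (_ , send)
  WFL-head ((μ g) w) with WFL-contractive w g
  ... | inj₁ (d , h) = inj₁ (_ , μ h)
  ... | inj₂ (x , v) = inj₂ (inj₁ (x , μ v))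
  WFL-head (var {x}) = inj₂ (inj₁ (x , var))
  WFL-head end       = inj₂ (inj₂ λ _ ())
  WFL-head stop      = inj₂ (inj₂ λ _ ())
  WFL-contractive w g with WFL-head w
  ... | inj₁ h                     = inj₁ h
  ... | inj₂ (inj₁ (zero , v))     = contradiction g (HeadVar⇒¬GuardedL v)
  ... | inj₂ (inj₁ (suc x , v))    = inj₂ (x , v)
  ... | inj₂ (inj₂ unguarded)      = contradiction g (unguarded zero)

  ∈-label-unique : ∀ {bs : Branches n} → Unique (labels bs) →
                   ∀ {a S T} → (a , S) ∈ bs → (a , T) ∈ bs → S ≡ T
  ∈-label-unique _ (here refl) (here refl) = refl
  ∈-label-unique (a∉ AllPairs.∷ _) (here refl) (there T∈) =
    contradiction refl (All.lookup a∉ (∈-map⁺ (label ∘ proj₁) T∈))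
  ∈-label-unique (a∉ AllPairs.∷ _) (there S∈) (here refl) =
    contradiction refl (All.lookup a∉ (∈-map⁺ (label ∘ proj₁) S∈))
  ∈-label-unique (_ AllPairs.∷ u) (there S∈) (there T∈) = ∈-label-unique u S∈ T∈

  WFL⇒Valid : ∀ {T : LType n} → WFL T → Valid T
  WFL⇒Valid (recv _ u _ w) = recv (∈-label-unique u) (λ T∈ → WFL⇒Valid (w T∈))
  WFL⇒Valid (send {bs = []} ne _ _ _) = contradiction refl ne
  WFL⇒Valid (send {bs = _ ∷ _} _ _ _ w) = send (here refl) (λ T∈ → WFL⇒Valid (w T∈))
  WFL⇒Valid ((μ g) w) = (μ WFL-contractive w g) (WFL⇒Valid w)
  WFL⇒Valid var  = var
  WFL⇒Valid end  = end
  WFL⇒Valid stop = stop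

  data Hnf : LType 0 → Set where
    recv : ∀ {p bs} → Hnf (recv p bs)
    send : ∀ {p bs} → Hnf (send p bs)
    end  : Hnf end
    stop : Hnf stop

  data Active : LType 0 → Set where
    recv : ∀ {p bs} → Active (recv p bs)
    send : ∀ {p bs} → Active (send p bs)

  infix 4 _⇓_
  -- Active rules out vacuous recursion, so that only end itself unfolds to end.
  data _⇓_ : LType 0 → LType 0 → Set where
    done   : ∀ {H} → Hnf H → H ⇓ H
    unfold : ∀ {T H} → Active H → unfoldL T ⇓ H → μ T ⇓ H

  ⇓-deterministic : ∀ {S H K} → S ⇓ H → S ⇓ K → H ≡ K
  ⇓-deterministic (done _)   (done _)   = refl
  ⇓-deterministic (unfold _ h) (unfold _ k) = ⇓-deterministic h k
  ⇓-deterministic (done ())  (unfold _ _)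
  ⇓-deterministic (unfold _ _) (done ())

  ⇓-Hnf : ∀ {S H} → S ⇓ H → Hnf H
  ⇓-Hnf (done h)   = h
  ⇓-Hnf (unfold _ h) = ⇓-Hnf h

  ⇓-Valid : ∀ {S H} → S ⇓ H → Valid S → Valid H
  ⇓-Valid (done _)   v = v
  ⇓-Valid (unfold _ h) v = ⇓-Valid h (Valid-unfold v)

  -- Substitution does not touch the leading binders, so each unfolding removes one of them and the
  -- index decreases.
  Headed-⇓ : ∀ {T} → Headed d T → ∃[ H ] T ⇓ H × Active H
  Headed-⇓ recv  = _ , done recv , recv
  Headed-⇓ send  = _ , done send , send
  Headed-⇓ (μ h) = let H , T⇓H , a = Headed-⇓ (Headed-sub h) in H , unfold a T⇓H , a

  Valid-μ-headed : ∀ {T : LType 1} → Valid (μ T) → IsHeaded (μ T)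
  Valid-μ-headed ((μ c) _) = let d , h = Contractive-closed c in suc d , μ h

  Valid-⇓ : ∀ {S} → Valid S → ∃[ H ] S ⇓ H
  Valid-⇓ (recv _ _) = _ , done recv
  Valid-⇓ (send _ _) = _ , done send
  Valid-⇓ v@((μ _) _) =
    let H , S⇓H , _ = Headed-⇓ (proj₂ (Valid-μ-headed v)) in H , S⇓H
  Valid-⇓ end  = _ , done end
  Valid-⇓ stop = _ , done stop

  -- Global types, absent roles and projection without merging

  data Proper {n} : GType n → Set where
    comm : ∀ {p q k} {ms : Vec Message (suc k)} {Gs} → p ≢ q →
           (∀ i → Proper (lookup Gs i)) → Proper (comm p q live ms Gs)
    μ_   : ∀ {G} → Proper G → Proper (μ G)
    var  : ∀ {x} → Proper (var x)
    end  : Proper end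

  Proper-ren : ∀ {ρ : Fin m → Fin n} {G} → Proper G → Proper (renG ρ G)
  Proper-ren (comm {Gs = Gs} p≢q ps) =
    comm p≢q λ i → subst Proper (sym (lookup-renGs _ Gs i)) (Proper-ren (ps i))
  Proper-ren (μ p) = μ Proper-ren p
  Proper-ren var   = var
  Proper-ren end   = end

  Proper-sub : ∀ {σ : Fin m → GType n} {G} → (∀ x → Proper (σ x)) → Proper G → Proper (subG σ G)
  Proper-sub pσ (comm {Gs = Gs} p≢q ps) =
    comm p≢q λ i → subst Proper (sym (lookup-subGs _ Gs i)) (Proper-sub pσ (ps i))
  Proper-sub pσ (μ p) = μ Proper-sub (λ { zero → var ; (suc x) → Proper-ren (pσ x) }) p
  Proper-sub pσ (var {x}) = pσ x
  Proper-sub pσ end = end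

  Proper-unfold : ∀ {G : GType 1} → Proper (μ G) → Proper (unfoldG G)
  Proper-unfold p@(μ p′) = Proper-sub (λ { zero → p ; (suc ()) }) p′

  WFG⇒Proper : ∀ {G : GType n} → WFG G → RuntimeFree G → Proper G
  WFG⇒Proper (comm c ws) (comm fs) =
    comm (WFChoice.distinct-roles c) λ i → WFG⇒Proper (ws i) (fs i)
  WFG⇒Proper ((μ _) w) (μ f) = μ WFG⇒Proper w f
  WFG⇒Proper var var = var
  WFG⇒Proper end end = end

  lift : Pred (Fin n) 0ℓ → Pred (Fin (suc n)) 0ℓ
  lift P zero    = ⊤
  lift P (suc x) = P x

  -- The predicate on the free variables carries closedness under binders.
  data Absent (p : Role) {n} (P : Pred (Fin n) 0ℓ) : GType n → Set where
    comm : ∀ {q r a k} {ms : Vec Message (suc k)} {Gs} → p ≢ q → p ≢ r →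
           (∀ i → Absent p P (lookup Gs i)) → Absent p P (comm q r a ms Gs)
    μ_   : ∀ {G} → Absent p (lift P) G → Absent p P (μ G)
    var  : ∀ {x} → P x → Absent p P (var x)
    end  : Absent p P end

  Absent-ren : ∀ {p P Q} {ρ : Fin m → Fin n} {G} → (∀ {x} → P x → Q (ρ x)) →
               Absent p P G → Absent p Q (renG ρ G)
  Absent-ren f (comm {Gs = Gs} p≢q p≢r as) =
    comm p≢q p≢r λ i → subst (Absent _ _) (sym (lookup-renGs _ Gs i)) (Absent-ren f (as i))
  Absent-ren f (μ a)   = μ Absent-ren (λ { {zero} _ → tt ; {suc x} → f }) a
  Absent-ren f (var h) = var (f h)
  Absent-ren f end     = end

  Absent-sub : ∀ {p P Q} {σ : Fin m → GType n} {G} → (∀ {x} → P x → Absent p Q (σ x)) →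
               Absent p P G → Absent p Q (subG σ G)
  Absent-sub f (comm {Gs = Gs} p≢q p≢r as) =
    comm p≢q p≢r λ i → subst (Absent _ _) (sym (lookup-subGs _ Gs i)) (Absent-sub f (as i))
  Absent-sub f (μ a) =
    μ Absent-sub (λ { {zero} _ → var tt ; {suc x} h → Absent-ren (λ h → h) (f h) }) a
  Absent-sub f (var h) = f h
  Absent-sub f end     = end

  Absent-unfold : ∀ {p} {G : GType 1} → Absent p ∅ (μ G) → Absent p ∅ (unfoldG G)
  Absent-unfold a@(μ a′) = Absent-sub (λ { {zero} _ → a ; {suc ()} }) a′

  -- T is above the projection of G in the order in which the merge of two
  -- types lies above both of them; unlike projection itself, this involves no
  -- merging, because T has only to be above the projection of every branch.
  data Proj (p : Role) {n} : GType n → LType n → Set where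
    absent : ∀ {G} → Absent p ∅ G → Proj p G end
    send   : ∀ {r a k bs} {ms : Vec Message (suc k)} {Gs} →
             (∀ {b T} → (b , T) ∈ bs → ∃[ i ] lookup ms i ≡ b × Proj p (lookup Gs i) T) →
             Proj p (comm p r a ms Gs) (send r bs)
    recv   : ∀ {q a k bs} {ms : Vec Message (suc k)} {Gs} → CrashHandled R q ms →
             (∀ i → ∃[ T ] (lookup ms i , T) ∈ bs × Proj p (lookup Gs i) T) →
             Proj p (comm q p a ms Gs) (recv q bs)
    other  : ∀ {q r a k T} {ms : Vec Message (suc k)} {Gs} → p ≢ q → p ≢ r →
             (∀ i → Proj p (lookup Gs i) T) → Proj p (comm q r a ms Gs) T
    rec    : ∀ {G T} → Contractive T → Proj p G T → Proj p (μ G) (μ T)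
    var    : ∀ {x} → Proj p (var x) (var x)

  Proj-ren : ∀ {p} {ρ : Fin m → Fin n} {G T} → Proj p G T → Proj p (renG ρ G) (renL ρ T)
  Proj-ren (absent a) = absent (Absent-ren (λ ()) a)
  Proj-ren {ρ = ρ} (send {bs = bs} {Gs = Gs} f) = send λ T∈ →
    let S , S∈ , eq = ∈-renLs⁻ bs T∈
        i , b≡ , P  = f S∈
    in i , b≡ , subst₂ (Proj _) (sym (lookup-renGs ρ Gs i)) (sym eq) (Proj-ren P)
  Proj-ren {ρ = ρ} (recv {Gs = Gs} ch f) = recv ch λ i →
    let T , T∈ , P = f i
    in renL ρ T , ∈-renLs⁺ T∈ , subst (λ G → Proj _ G _) (sym (lookup-renGs ρ Gs i)) (Proj-ren P)
  Proj-ren {ρ = ρ} (other {Gs = Gs} p≢q p≢r f) =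
    other p≢q p≢r λ i → subst (λ G → Proj _ G _) (sym (lookup-renGs ρ Gs i)) (Proj-ren (f i))
  Proj-ren (rec c P) = rec (Contractive-ren c) (Proj-ren P)
  Proj-ren var = var

  Proj-sub : ∀ {p} {σ : Fin m → GType n} {τ : Fin m → LType n} {G T} →
             (∀ x → HeadedOrVar (τ x)) → (∀ x → Proj p (σ x) (τ x)) →
             Proj p G T → Proj p (subG σ G) (subL τ T)
  Proj-sub hτ f (absent a) = absent (Absent-sub (λ ()) a)
  Proj-sub {σ = σ} hτ f (send {bs = bs} {Gs = Gs} g) = send λ T∈ →
    let S , S∈ , eq = ∈-subLs⁻ bs T∈
        i , b≡ , P  = g S∈
    in i , b≡ , subst₂ (Proj _) (sym (lookup-subGs σ Gs i)) (sym eq) (Proj-sub hτ f P)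
  Proj-sub {σ = σ} {τ} hτ f (recv {Gs = Gs} ch g) = recv ch λ i →
    let T , T∈ , P = g i
    in subL τ T , ∈-subLs⁺ T∈ ,
       subst (λ G → Proj _ G _) (sym (lookup-subGs σ Gs i)) (Proj-sub hτ f P)
  Proj-sub {σ = σ} hτ f (other {Gs = Gs} p≢q p≢r g) = other p≢q p≢r λ i →
    subst (λ G → Proj _ G _) (sym (lookup-subGs σ Gs i)) (Proj-sub hτ f (g i))
  Proj-sub hτ f (rec c P) = rec (Contractive-sub hτ c)
    (Proj-sub (extsL-HeadedOrVar hτ) (λ { zero → var ; (suc x) → Proj-ren (f x) }) P)
  Proj-sub hτ f (var {x}) = f x

  Proj-unfold : ∀ {p} {G : GType 1} {T} → Proj p (μ G) (μ T) → Proj p (unfoldG G) (unfoldL T)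
  Proj-unfold P@(rec c P′) =
    Proj-sub (oneL-HeadedOrVar (μ proj₂ (Contractive-closed c)))
             (λ { zero → P ; (suc ()) }) P′

  -- Merging, in terms of the order it induces

  infix 4 _⊒_
  -- These are the structural rules of subtyping, read inductively on open types, with congruence
  -- for `μ` instead of unfolding and without the conditions on crash branches, which merging can
  -- violate.
  data _⊒_ {n} : LType n → LType n → Set where
    recv : ∀ {p bs cs} → (∀ {a T} → (a , T) ∈ cs → ∃[ S ] (a , S) ∈ bs × S ⊒ T) →
           recv p bs ⊒ recv p cs
    send : ∀ {p bs cs} → (∀ {a S} → (a , S) ∈ bs → ∃[ T ] (a , T) ∈ cs × S ⊒ T) →
           send p bs ⊒ send p cs
    μ_   : ∀ {S T} → S ⊒ T → μ S ⊒ μ T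
    var  : ∀ {x} → var x ⊒ var x
    end  : end ⊒ end
    stop : stop ⊒ stop

  ⊒-refl  : (T : LType n) → T ⊒ T
  ⊒-refls : (bs : Branches n) → ∀ {a T} → (a , T) ∈ bs → T ⊒ T
  ⊒-refl (recv p bs) = recv λ T∈ → _ , T∈ , ⊒-refls bs T∈
  ⊒-refl (send p bs) = send λ T∈ → _ , T∈ , ⊒-refls bs T∈
  ⊒-refl (μ T)       = μ ⊒-refl T
  ⊒-refl (var x)     = var
  ⊒-refl end         = end
  ⊒-refl stop        = stop
  ⊒-refls ((_ , T) ∷ bs) (here refl) = ⊒-refl T
  ⊒-refls ((_ , T) ∷ bs) (there T∈)  = ⊒-refls bs T∈

  ⊒-trans : ∀ {S T U : LType n} → S ⊒ T → T ⊒ U → S ⊒ U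
  ⊒-trans (recv f) (recv g) = recv λ U∈ →
    let T , T∈ , T⊒U = g U∈
        S , S∈ , S⊒T = f T∈
    in S , S∈ , ⊒-trans S⊒T T⊒U
  ⊒-trans (send f) (send g) = send λ S∈ →
    let T , T∈ , S⊒T = f S∈
        U , U∈ , T⊒U = g T∈
    in U , U∈ , ⊒-trans S⊒T T⊒U
  ⊒-trans (μ s) (μ t) = μ ⊒-trans s t
  ⊒-trans var var = var
  ⊒-trans end end = end
  ⊒-trans stop stop = stop

  ∈-++-∷⁺ : ∀ {A : Set} {x y : A} xs {ys} → x ∈ xs ++ ys → x ∈ xs ++ y ∷ ys
  ∈-++-∷⁺ []       x∈          = there x∈
  ∈-++-∷⁺ (_ ∷ xs) (here refl) = here refl
  ∈-++-∷⁺ (_ ∷ xs) (there x∈)  = there (∈-++-∷⁺ xs x∈)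

  ∈-++-∷⁻ : ∀ {A : Set} {x y : A} xs {ys} → x ∈ xs ++ y ∷ ys → x ≡ y ⊎ x ∈ xs ++ ys
  ∈-++-∷⁻ []       (here refl) = inj₁ refl
  ∈-++-∷⁻ []       (there x∈)  = inj₂ x∈
  ∈-++-∷⁻ (_ ∷ xs) (here refl) = inj₂ (here refl)
  ∈-++-∷⁻ (_ ∷ xs) (there x∈) with ∈-++-∷⁻ xs x∈
  ... | inj₁ eq  = inj₁ eq
  ... | inj₂ x∈′ = inj₂ (there x∈′)

  ⊓-upperˡ : ∀ {S T U : LType n} → S ⊓ T ≈ U → U ⊒ S
  ⊓-upperʳ : ∀ {S T U : LType n} → S ⊓ T ≈ U → U ⊒ T
  MergeExt-upperˡ : ∀ {bs cs ds : Branches n} → MergeExt bs cs ds →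
                    ∀ {a S} → (a , S) ∈ bs → ∃[ U ] (a , U) ∈ ds × U ⊒ S
  MergeExt-upperʳ : ∀ {bs cs ds : Branches n} → MergeExt bs cs ds →
                    ∀ {a T} → (a , T) ∈ cs → ∃[ U ] (a , U) ∈ ds × U ⊒ T
  MergeInt-upperˡ : ∀ {bs cs ds : Branches n} → MergeInt bs cs ds →
                    ∀ {a U} → (a , U) ∈ ds → ∃[ S ] (a , S) ∈ bs × U ⊒ S
  MergeInt-upperʳ : ∀ {bs cs ds : Branches n} → MergeInt bs cs ds →
                    ∀ {a U} → (a , U) ∈ ds → ∃[ T ] (a , T) ∈ cs × U ⊒ T

  ⊓-upperˡ (recv x) = recv (MergeExt-upperˡ x)
  ⊓-upperˡ (send x) = send (MergeInt-upperˡ x)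
  ⊓-upperˡ (μ x) = μ ⊓-upperˡ x
  ⊓-upperˡ var = var
  ⊓-upperˡ end = end

  ⊓-upperʳ (recv x) = recv (MergeExt-upperʳ x)
  ⊓-upperʳ (send x) = send (MergeInt-upperʳ x)
  ⊓-upperʳ (μ x) = μ ⊓-upperʳ x
  ⊓-upperʳ var = var
  ⊓-upperʳ end = end

  MergeExt-upperˡ (both s x) (here refl) = _ , here refl , ⊓-upperˡ s
  MergeExt-upperˡ (both s x) (there S∈) =
    let U , U∈ , h = MergeExt-upperˡ x S∈ in U , there U∈ , h
  MergeExt-upperˡ (left _ x) (here refl) = _ , here refl , ⊒-refl _
  MergeExt-upperˡ (left _ x) (there S∈) =
    let U , U∈ , h = MergeExt-upperˡ x S∈ in U , there U∈ , h

  MergeExt-upperʳ rest T∈ = _ , T∈ , ⊒-refl _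
  MergeExt-upperʳ (both {cs₁ = cs₁} s x) T∈ with ∈-++-∷⁻ cs₁ T∈
  ... | inj₁ refl = _ , here refl , ⊓-upperʳ s
  ... | inj₂ T∈′  = let U , U∈ , h = MergeExt-upperʳ x T∈′ in U , there U∈ , h
  MergeExt-upperʳ (left _ x) T∈ =
    let U , U∈ , h = MergeExt-upperʳ x T∈ in U , there U∈ , h

  MergeInt-upperˡ (both s x) (here refl) = _ , here refl , ⊓-upperˡ s
  MergeInt-upperˡ (both s x) (there U∈) =
    let S , S∈ , h = MergeInt-upperˡ x U∈ in S , there S∈ , h

  MergeInt-upperʳ (both {cs₁ = cs₁} s x) (here refl) = _ , ∈-++⁺ʳ cs₁ (here refl) , ⊓-upperʳ s
  MergeInt-upperʳ (both {cs₁ = cs₁} s x) (there U∈) =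
    let T , T∈ , h = MergeInt-upperʳ x U∈ in T , ∈-++-∷⁺ cs₁ T∈ , h

  ⨅-upper : ∀ {Ts : Vec (LType n) (suc k)} {T} → ⨅ Ts ≈ T → ∀ i → T ⊒ lookup Ts i
  ⨅-upper one        zero    = ⊒-refl _
  ⨅-upper (more _ s) zero    = ⊓-upperˡ s
  ⨅-upper (more t s) (suc i) = ⊒-trans (⊓-upperʳ s) (⨅-upper t i)

  Headed-⊒ : ∀ {S T : LType n} → S ⊒ T → Headed d T → Headed d S
  Headed-⊒ (recv _) recv = recv
  Headed-⊒ (send _) send = send
  Headed-⊒ (μ s) (μ h)   = μ Headed-⊒ s h

  HeadVar-⊒ : ∀ {S T : LType n} {x} → S ⊒ T → HeadVar x T → HeadVar x S
  HeadVar-⊒ var   var   = var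
  HeadVar-⊒ (μ s) (μ v) = μ HeadVar-⊒ s v

  Contractive-⊒ : ∀ {S T : LType (suc n)} → S ⊒ T → Contractive T → Contractive S
  Contractive-⊒ s (inj₁ (d , h)) = inj₁ (d , Headed-⊒ s h)
  Contractive-⊒ s (inj₂ (x , v)) = inj₂ (x , HeadVar-⊒ s v)

  -- Projections are contractive and contained in `Proj`

  headed? : (T : LType n) → IsHeaded T ⊎ ¬ IsHeaded T
  headed? (recv _ _) = inj₁ (_ , recv)
  headed? (send _ _) = inj₁ (_ , send)
  headed? (μ T) with headed? T
  ... | inj₁ (d , h) = inj₁ (suc d , μ h)
  ... | inj₂ ¬h      = inj₂ λ { (_ , μ h) → ¬h (_ , h) }
  headed? (var _) = inj₂ λ ()
  headed? end     = inj₂ λ ()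
  headed? stop    = inj₂ λ ()

  ∈-branches⁺ : ∀ (ms : Vec Message k) (Ts : Vec (LType n) k) i →
                (lookup ms i , lookup Ts i) ∈ branches ms Ts
  ∈-branches⁺ (_ ∷ ms) (_ ∷ Ts) zero    = here refl
  ∈-branches⁺ (_ ∷ ms) (_ ∷ Ts) (suc i) = there (∈-branches⁺ ms Ts i)

  ∈-branches⁻ : ∀ (ms : Vec Message k) (Ts : Vec (LType n) k) {b} → b ∈ branches ms Ts →
                ∃[ i ] b ≡ (lookup ms i , lookup Ts i)
  ∈-branches⁻ [] [] ()
  ∈-branches⁻ (_ ∷ ms) (_ ∷ Ts) (here refl) = zero , refl
  ∈-branches⁻ (_ ∷ ms) (_ ∷ Ts) (there b∈)  =
    let i , eq = ∈-branches⁻ ms Ts b∈ in suc i , eq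

  -- A projection with neither a communication nor end at its head is a chain
  -- of binders over the only variable free in G; the side condition of the
  -- rule for μ then makes every projection contractive.
  projection-head : ∀ {p} {G : GType n} {T} → Proper G → G ↾[ R ] p ≈ T →
                    IsHeaded T ⊎ (¬ Occurs p G × (∀ {x} → FreeIn x G → HeadVar x T))
  projection-head _ (send _)   = inj₁ (_ , send)
  projection-head _ (recv _ _) = inj₁ (_ , recv)
  projection-head {T = T} (comm _ ps) (other p≢q p≢r f ⨅T) with headed? T
  ... | inj₁ h  = inj₁ h
  ... | inj₂ ¬h = inj₂ ((λ { (comm (inj₁ eq)) → p≢q eq
                           ; (comm (inj₂ eq)) → p≢r eq
                           ; (branch i o) → proj₁ (unheaded i) o }) ,
                        λ { (branch i v) → HeadVar-⊒ (⨅-upper ⨅T i) (proj₂ (unheaded i) v) })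
    where
    unheaded : ∀ i → _
    unheaded i with projection-head (ps i) (f i)
    ... | inj₁ (d , h) = contradiction (d , Headed-⊒ (⨅-upper ⨅T i) h) ¬h
    ... | inj₂ u       = u
  projection-head (μ pr) (rec _ f) with projection-head pr f
  ... | inj₁ (d , h)   = inj₁ (suc d , μ h)
  ... | inj₂ (¬o , hv) = inj₂ ((λ { (μ o) → ¬o o }) , λ { (μ v) → μ hv v })
  projection-head _ (rec-end ¬side) =
    inj₂ ((λ { (μ o) → ¬side (inj₁ o) }) , λ v → contradiction (inj₂ (_ , v)) ¬side)
  projection-head _ var = inj₂ ((λ ()) , λ { var → var })
  projection-head _ end = inj₂ ((λ ()) , λ ())

  projection-contractive : ∀ {p} {G : GType (suc n)} {T} → Proper G → G ↾[ R ] p ≈ T →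
                           Occurs p G ⊎ (∃[ x ] FreeIn x (μ G)) → Contractive T
  projection-contractive pr f side with projection-head pr f
  ... | inj₁ h = inj₁ h
  projection-contractive pr f (inj₁ o) | inj₂ (¬o , _) = contradiction o ¬o
  projection-contractive pr f (inj₂ (x , μ v)) | inj₂ (_ , hv) = inj₂ (x , hv v)

  ¬Occurs⇒Absent : ∀ {p P} {G : GType n} → Proper G → ¬ Occurs p G →
                   (∀ {x} → FreeIn x G → P x) → Absent p P G
  ¬Occurs⇒Absent (comm _ ps) ¬o fv = comm
    (λ eq → ¬o (comm (inj₁ eq))) (λ eq → ¬o (comm (inj₂ eq)))
    λ i → ¬Occurs⇒Absent (ps i) (λ o → ¬o (branch i o)) (λ v → fv (branch i v))
  ¬Occurs⇒Absent (μ pr) ¬o fv =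
    μ ¬Occurs⇒Absent pr (λ o → ¬o (μ o)) (λ { {zero} _ → tt ; {suc x} v → fv (μ v) })
  ¬Occurs⇒Absent var _ fv = var (fv var)
  ¬Occurs⇒Absent end _ _  = end

  -- The generalisation to every `S` above the projection is what the induction needs: a merge
  -- replaces the projections of the branches by a single type above each of them.
  Projects⇒Proj : ∀ {p} {G : GType n} {S T} → Proper G → G ↾[ R ] p ≈ T → S ⊒ T → Proj p G S
  Projects⇒Proj (comm _ ps) (send {ms = ms} {Ts = Ts} f) (send g) = send λ S∈ →
    let T , T∈ , S⊒T = g S∈
        T∈′ , T≢crash = ∈-filter⁻ (¬? ∘ crash? ∘ proj₁) {xs = branches ms Ts} T∈
        i , eq = ∈-branches⁻ ms Ts T∈′
        b≡ = sym (cong proj₁ eq)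
    in i , b≡ , Projects⇒Proj (ps i) (f i λ c → T≢crash (trans (sym b≡) c))
                              (subst (_ ⊒_) (cong proj₂ eq) S⊒T)
  Projects⇒Proj (comm _ ps) (recv {ms = ms} {Ts = Ts} ch f) (recv g) = recv ch λ i →
    let S , S∈ , S⊒T = g (∈-branches⁺ ms Ts i)
    in S , S∈ , Projects⇒Proj (ps i) (f i) S⊒T
  Projects⇒Proj (comm _ ps) (other p≢q p≢r f ⨅T) s = other p≢q p≢r λ i →
    Projects⇒Proj (ps i) (f i) (⊒-trans s (⨅-upper ⨅T i))
  Projects⇒Proj (μ pr) (rec side f) (μ s) =
    rec (Contractive-⊒ s (projection-contractive pr f side)) (Projects⇒Proj pr f s)
  Projects⇒Proj pr@(μ _) (rec-end ¬side) end =
    absent (¬Occurs⇒Absent pr (λ { (μ o) → ¬side (inj₁ o) }) λ v → ¬side (inj₂ (_ , v)))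
  Projects⇒Proj _ var var = var
  Projects⇒Proj _ end end = absent end

  -- Depth of occurrences

  -- Occurrence below at most d binders and communications: unfolding a
  -- recursion keeps the bound, unlike the size of a derivation of Occurs.
  data OccursAt {n} (p : Role) : ℕ → GType n → Set where
    comm   : ∀ {q r a k} {ms : Vec Message (suc k)} {Gs} →
             p ≡ q ⊎ p ≡ r → OccursAt p d (comm q r a ms Gs)
    branch : ∀ {q r a k} {ms : Vec Message (suc k)} {Gs} i →
             OccursAt p d (lookup Gs i) → OccursAt p (suc d) (comm q r a ms Gs)
    μ_     : ∀ {G} → OccursAt p d G → OccursAt p (suc d) (μ G)

  OccursAt-sub : ∀ {p} {σ : Fin m → GType n} {G} → OccursAt p d G → OccursAt p d (subG σ G)
  OccursAt-sub (comm e) = comm e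
  OccursAt-sub {σ = σ} (branch {Gs = Gs} i o) =
    branch i (subst (OccursAt _ _) (sym (lookup-subGs σ Gs i)) (OccursAt-sub o))
  OccursAt-sub (μ o) = μ OccursAt-sub o

  Occurs⇒OccursAt : ∀ {p} {G : GType n} → Proper G → Occurs p G → ∃[ d ] OccursAt p d G
  Occurs⇒OccursAt _ (comm e) = zero , comm e
  Occurs⇒OccursAt (comm _ ps) (branch i o) =
    let d , o′ = Occurs⇒OccursAt (ps i) o in suc d , branch i o′
  Occurs⇒OccursAt (μ pr) (μ o) = let d , o′ = Occurs⇒OccursAt pr o in suc d , μ o′

  OccursAt⇒Roles : ∀ {p} {G : GType n} → Proper G → OccursAt p d G → Roles G p
  OccursAt⇒Roles (comm _ _) (comm (inj₁ refl)) = sender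
  OccursAt⇒Roles (comm _ _) (comm (inj₂ refl)) = receiver
  OccursAt⇒Roles (comm _ ps) (branch i o) = branch i (OccursAt⇒Roles (ps i) o)
  OccursAt⇒Roles pr@(μ pr′) (μ o) = unfold (OccursAt⇒Roles
    (Proper-sub (λ { zero → pr ; (suc _) → var }) pr′) (OccursAt-sub o))

  -- Bounded like OccursAt, so that recursion on the bound can unfold.
  data Reaches {n} (p : Role) : ℕ → GType n → Set where
    sender   : ∀ {q a k} {ms : Vec Message (suc k)} {Gs} → Reaches p d (comm p q a ms Gs)
    receiver : ∀ {q a k} {ms : Vec Message (suc k)} {Gs} → Reaches p d (comm q p a ms Gs)
    comm     : ∀ {q r a k} {ms : Vec Message (suc k)} {Gs} → p ≢ q → p ≢ r →
               (∀ i → Reaches p d (lookup Gs i)) → Reaches p (suc d) (comm q r a ms Gs)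
    μ_       : ∀ {G} → Reaches p d G → Reaches p (suc d) (μ G)

  Reaches-sub : ∀ {p} {σ : Fin m → GType n} {G} → Reaches p d G → Reaches p d (subG σ G)
  Reaches-sub sender   = sender
  Reaches-sub receiver = receiver
  Reaches-sub {σ = σ} (comm {Gs = Gs} p≢q p≢r f) =
    comm p≢q p≢r λ i → subst (Reaches _ _) (sym (lookup-subGs σ Gs i)) (Reaches-sub (f i))
  Reaches-sub (μ r) = μ Reaches-sub r

  Reaches-suc : ∀ {p} {G : GType n} → Reaches p d G → Reaches p (suc d) G
  Reaches-suc sender   = sender
  Reaches-suc receiver = receiver
  Reaches-suc (comm p≢q p≢r f) = comm p≢q p≢r λ i → Reaches-suc (f i)
  Reaches-suc (μ r)    = μ Reaches-suc r

  ≤-monotone : (P : ℕ → Set) → (∀ {n} → P n → P (suc n)) → ∀ {m n} → m ≤ n → P m → P n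
  ≤-monotone P step m≤n = go (≤⇒≤′ m≤n)
    where
    go : ∀ {m n} → m ≤′ n → P m → P n
    go ≤′-refl     x = x
    go (≤′-step l) x = step (go l x)

  uniform-bound : ∀ (P : ℕ → Fin k → Set) → (∀ {n i} → P n i → P (suc n) i) →
                  (∀ i → ∃[ n ] P n i) → ∃[ n ] ∀ i → P n i
  uniform-bound {k = zero}  P step f = zero , λ ()
  uniform-bound {k = suc k} P step f =
    let n₀ , x₀ = f zero
        n , x   = uniform-bound (λ n i → P n (suc i)) step (f ∘ suc)
    in n₀ ⊔ n , λ { zero    → ≤-monotone (λ n → P n zero) step (m≤m⊔n n₀ n) x₀
                  ; (suc i) → ≤-monotone (λ n → P n (suc i)) step (m≤n⊔m n₀ n) (x i) }

  -- Since `other` hands `T` unchanged to every branch, while `absent` and `var` give no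
  -- communication, each path must meet one of `p`. The branches give different bounds, of which the
  -- maximum is taken.
  Proj-reaches : ∀ {p} {G : GType n} {T} → Proj p G T → Headed d T → ∃[ e ] Reaches p e G
  Proj-reaches (send _)   h = zero , sender
  Proj-reaches (recv _ _) h = zero , receiver
  Proj-reaches (other p≢q p≢r f) h =
    let e , r = uniform-bound _ Reaches-suc (λ i → Proj-reaches (f i) h)
    in suc e , comm p≢q p≢r r
  Proj-reaches (rec _ P) (μ h) = let e , r = Proj-reaches P h in suc e , μ r

  -- Subtyping between head normal forms

  -- The relation chooses on which side to unfold next; recursion on both unfolding derivations
  -- follows that choice in whatever order it is made.
  ≲-⇓ : ∀ {_≲_ : LType 0 → LType 0 → Set} → (∀ {S T} → S ≲ T → SubRule _≲_ S T) →
        ∀ {S T H K} → S ⇓ H → T ⇓ K → S ≲ T → H ≲ K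
  ≲-⇓ cl (done _) (done _) s = s
  ≲-⇓ cl (unfold a h) k s with cl s
  ≲-⇓ cl (unfold a h) k s          | unfoldˡ s′ = ≲-⇓ cl h k s′
  ≲-⇓ cl (unfold a h) (unfold _ k) s | unfoldʳ s′ = ≲-⇓ cl (unfold a h) k s′
  ≲-⇓ cl (done hnf) (unfold _ k) s with cl s
  ≲-⇓ cl (done ()) (unfold _ k) s | unfoldˡ _
  ... | unfoldʳ s′ = ≲-⇓ cl (done hnf) k s′

  record Settled (H : LType 0) : Set where
    constructor settled
    field
      hnf   : Hnf H
      valid : Valid H

  ⇓-Settled : ∀ {S H} → S ⇓ H → Valid S → Settled H
  ⇓-Settled h v = settled (⇓-Hnf h) (⇓-Valid h v)

  send-Valid : ∀ {q} {bs : Branches n} {a T} → Valid (send q bs) → (a , T) ∈ bs → Valid T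
  send-Valid (send _ v) = v

  recv-Valid : ∀ {q} {bs : Branches n} {a T} → Valid (recv q bs) → (a , T) ∈ bs → Valid T
  recv-Valid (recv _ v) = v

  recv-functional : ∀ {q} {bs : Branches n} {a S T} → Valid (recv q bs) →
                    (a , S) ∈ bs → (a , T) ∈ bs → S ≡ T
  recv-functional (recv f _) = f

  -- Between head normal forms only the structural rules of subtyping apply, so inversion yields the
  -- communication at once. `T` is kept beside `K` because `Proj` speaks of the type before
  -- unfolding.
  Follows : Role → LType 0 → GType 0 → Set₁
  Follows p H G = ∃[ T ] ∃[ K ] Proj p G T × T ⇓ K × H ⩽ K

  Proj-⇓ : ∀ {p} {G : GType 0} {T} → Proj p G T → ∃[ K ] T ⇓ K
  Proj-⇓ (absent _) = _ , done end
  Proj-⇓ (send _)   = _ , done send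
  Proj-⇓ (recv _ _) = _ , done recv
  Proj-⇓ (other _ _ f) = Proj-⇓ (f zero)
  Proj-⇓ (rec c _) =
    let K , T⇓K , _ = Headed-⇓ (μ proj₂ (Contractive-closed c)) in K , T⇓K

  Proj-not-stop : ∀ {p} {G : GType 0} {T} → Proj p G T → ¬ T ⇓ stop
  Proj-not-stop (absent _) ()
  Proj-not-stop (other _ _ f) h = Proj-not-stop (f zero) h
  Proj-not-stop (rec _ _) (unfold () _)

  ⩽-stop : ∀ {K} → Hnf K → stop ⩽ K → K ≡ stop
  ⩽-stop hnf (_ , cl , s) with cl s
  ... | stop = refl
  ⩽-stop () (_ , cl , s) | unfoldʳ _

  Follows-not-stop : ∀ {p G} → ¬ Follows p stop G
  Follows-not-stop (T , K , P , T⇓K , s) with ⩽-stop (⇓-Hnf T⇓K) s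
  ... | refl = Proj-not-stop P T⇓K

  Follows-unfold : ∀ {p H G} → Follows p H (μ G) → Follows p H (unfoldG G)
  Follows-unfold (_ , K , absent a , h , s) = _ , K , absent (Absent-unfold a) , h , s
  Follows-unfold (_ , K , rec c P , unfold _ h , s) = _ , K , Proj-unfold (rec c P) , h , s

  Follows-other : ∀ {p H q r a k} {ms : Vec Message (suc k)} {Gs} → p ≢ q → p ≢ r →
                  Follows p H (comm q r a ms Gs) → ∀ i → Follows p H (lookup Gs i)
  Follows-other p≢q p≢r (T , K , absent (comm _ _ a) , h , s) i = T , K , absent (a i) , h , s
  Follows-other p≢q p≢r (T , K , other _ _ f , h , s) i = T , K , f i , h , s
  Follows-other p≢q p≢r (T , K , send _ , h , s) i = contradiction refl p≢q
  Follows-other p≢q p≢r (T , K , recv _ _ , h , s) i = contradiction refl p≢r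

  Follows-send : ∀ {p H r a k} {ms : Vec Message (suc k)} {Gs} → p ≢ r → Settled H →
                 Follows p H (comm p r a ms Gs) →
                 ∃[ bs ] H ≡ send r bs × (∀ {b S} → (b , S) ∈ bs →
                   ∃[ i ] lookup ms i ≡ b × ∃[ H′ ] S ⇓ H′ × Follows p H′ (lookup Gs i))
  Follows-send p≢r _ (_ , _ , absent (comm p≢p _ _) , _) = contradiction refl p≢p
  Follows-send p≢r _ (_ , _ , other p≢p _ _ , _)         = contradiction refl p≢p
  Follows-send p≢r _ (_ , _ , recv _ _ , _)              = contradiction refl p≢r
  Follows-send p≢r (settled hnf v) (_ , _ , send f , done send , _≲_ , cl , s) with cl s
  Follows-send p≢r (settled () v) (_ , _ , send f , done send , _≲_ , cl , s) | unfoldˡ _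
  ... | send g = _ , refl , λ S∈ →
    let T , T∈ , S≲T = g S∈
        i , b≡ , P   = f T∈
        H′ , S⇓H′    = Valid-⇓ (send-Valid v S∈)
        K′ , T⇓K′    = Proj-⇓ P
    in i , b≡ , H′ , S⇓H′ , T , K′ , P , T⇓K′ , _≲_ , cl , ≲-⇓ cl S⇓H′ T⇓K′ S≲T

  Follows-recv : ∀ {p H q a k} {ms : Vec Message (suc k)} {Gs} → q ≢ p → Settled H →
                 Follows p H (comm q p a ms Gs) →
                 ∃[ bs ] H ≡ recv q bs × CrashHandled R q ms × (∀ i →
                   ∃[ S ] (lookup ms i , S) ∈ bs × ∃[ H′ ] S ⇓ H′ × Follows p H′ (lookup Gs i))
  Follows-recv q≢p _ (_ , _ , absent (comm _ p≢p _) , _) = contradiction refl p≢p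
  Follows-recv q≢p _ (_ , _ , other _ p≢p _ , _)         = contradiction refl p≢p
  Follows-recv q≢p _ (_ , _ , send _ , _)                = contradiction refl q≢p
  Follows-recv q≢p (settled hnf v) (_ , _ , recv ch f , done recv , _≲_ , cl , s) with cl s
  Follows-recv q≢p (settled () v) (_ , _ , recv ch f , done recv , _≲_ , cl , s) | unfoldˡ _
  ... | recv g _ _ = _ , refl , ch , λ i →
    let T , T∈ , P = f i
        S , S∈ , S≲T = g T∈
        H′ , S⇓H′    = Valid-⇓ (recv-Valid v S∈)
        K′ , T⇓K′    = Proj-⇓ P
    in S , S∈ , H′ , S⇓H′ , T , K′ , P , T⇓K′ , _≲_ , cl , ≲-⇓ cl S⇓H′ T⇓K′ S≲T

  ⩽-Active : ∀ {H K} → Hnf K → Active H → H ⩽ K → Active K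
  ⩽-Active hnf recv (_ , cl , s) with cl s
  ... | recv _ _ _ = recv
  ⩽-Active () recv (_ , cl , s) | unfoldʳ _
  ⩽-Active hnf send (_ , cl , s) with cl s
  ... | send _ = send
  ⩽-Active () send (_ , cl , s) | unfoldʳ _

  -- This justifies lazy execution: a role that is about to communicate has its communication at
  -- bounded depth on every path, so a finite unrolling exposes it.
  Follows-reaches : ∀ {p H G} → Active H → Follows p H G → ∃[ d ] Reaches p d G
  Follows-reaches a (T , K , P , T⇓K , s) =
    Proj-reaches P (proj₂ (headed P T⇓K (⩽-Active (⇓-Hnf T⇓K) a s)))
    where
    headed : ∀ {p G T K} → Proj p G T → T ⇓ K → Active K → IsHeaded T
    headed (send _)      _ _ = _ , send
    headed (recv _ _)    _ _ = _ , recv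
    headed (other _ _ f) h a = headed (f zero) h a
    headed (rec c _)     _ _ = let d , h = Contractive-closed c in suc d , μ h
    headed (absent _) (done _) ()

  -- Execution trees and the roles that follow them

  -- A global type in the course of execution: leaves have not been reached by
  -- any action, enroute p q b t has a message b from p to q in transit, and
  -- the branches that were not chosen are forgotten. Crashes leave no trace:
  -- a node whose receiver, or both of whose roles, are crashed is stale.
  data Tree : Set where
    leaf    : (G : GType 0) → Proper G → Tree
    comm    : (p q : Role) → p ≢ q → Vec Message (suc k) → (Fin (suc k) → Tree) → Tree
    enroute : Role → Role → Message → Tree → Tree

  -- In the unrolled part subtyping and projection are already resolved into membership conditions;
  -- they survive only at leaves. An internal choice needs a branch for each message it may send, an
  -- external choice an answer to every branch. In `other` one `H` serves all branches, as `p` does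
  -- not know the choice. The sender of a message in transit has done its part and falls under
  -- `pass`.
  data Sim (p : Role) : LType 0 → Tree → Set₁ where
    leaf   : ∀ {H G pr} → Follows p H G → Sim p H (leaf G pr)
    send   : ∀ {r bs ne} {ms : Vec Message (suc k)} {ts} →
             (∀ {b S} → (b , S) ∈ bs →
               ∃[ i ] lookup ms i ≡ b × ∃[ H ] S ⇓ H × Sim p H (ts i)) →
             Sim p (send r bs) (comm p r ne ms ts)
    recv   : ∀ {q bs ne} {ms : Vec Message (suc k)} {ts} → CrashHandled R q ms →
             (∀ i → ∃[ S ] (lookup ms i , S) ∈ bs × ∃[ H ] S ⇓ H × Sim p H (ts i)) →
             Sim p (recv q bs) (comm q p ne ms ts)
    other  : ∀ {H q r ne} {ms : Vec Message (suc k)} {ts} → p ≢ q → p ≢ r →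
             (∀ i → Sim p H (ts i)) → Sim p H (comm q r ne ms ts)
    arrive : ∀ {q bs b S H t} → (b , S) ∈ bs → S ⇓ H → Sim p H t →
             Sim p (recv q bs) (enroute q p b t)
    pass   : ∀ {H q r b t} → p ≢ r → Sim p H t → Sim p H (enroute q r b t)

  -- A communication from p to q that has not started cannot lie above a message
  -- in transit from p to q.
  data Pending (p q : Role) : List Message → Tree → Set where
    leaf  : ∀ {G pr} → Pending p q [] (leaf G pr)
    comm  : ∀ {τ x y ne} {ms : Vec Message (suc k)} {ts} → (x ≡ p → y ≡ q → τ ≡ []) →
            (∀ i → Pending p q τ (ts i)) → Pending p q τ (comm x y ne ms ts)
    here  : ∀ {τ b t} → Pending p q τ t → Pending p q (b ∷ τ) (enroute p q b t)
    there : ∀ {τ x y b t} → ¬ (x ≡ p × y ≡ q) → Pending p q τ t →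
            Pending p q τ (enroute x y b t)

  infix 4 _≼_
  data _≼_ : Tree → Tree → Set where
    leaf    : ∀ {G pr} → leaf G pr ≼ leaf G pr
    unroll  : ∀ {G pr pr′ t} → leaf (unfoldG G) pr′ ≼ t → leaf (μ G) pr ≼ t
    expand  : ∀ {p q ne} {ms : Vec Message (suc k)} {Gs pr ts} {prs : ∀ i → Proper (lookup Gs i)} →
              (∀ i → leaf (lookup Gs i) (prs i) ≼ ts i) →
              leaf (comm p q live ms Gs) pr ≼ comm p q ne ms ts
    comm    : ∀ {p q ne} {ms : Vec Message (suc k)} {ts us} → (∀ i → ts i ≼ us i) →
              comm p q ne ms ts ≼ comm p q ne ms us
    enroute : ∀ {p q b t u} → t ≼ u → enroute p q b t ≼ enroute p q b u

  ≼-refl : ∀ t → t ≼ t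
  ≼-refl (leaf G pr)          = leaf
  ≼-refl (comm p q ne ms ts)  = comm λ i → ≼-refl (ts i)
  ≼-refl (enroute p q b t)    = enroute (≼-refl t)

  -- Expanding a leaf inverts subtyping and projection into the constructors of `Sim`. `Settled` is
  -- carried along because this inversion starts from a head normal form and the continuations must
  -- have one again.
  Sim-≼ : ∀ {p H t u} → Settled H → t ≼ u → Sim p H t → Sim p H u
  Sim-≼ st leaf s = s
  Sim-≼ st (unroll r) (leaf f) = Sim-≼ st r (leaf (Follows-unfold f))
  Sim-≼ {p} st (expand {p = q} {r} {ne} rs) (leaf f) with p ≟ q | p ≟ r
  ... | no p≢q | no p≢r = other p≢q p≢r λ i → Sim-≼ st (rs i) (leaf (Follows-other p≢q p≢r f i))
  ... | yes refl | _ with Follows-send ne st f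
  ...   | bs , refl , g = send λ S∈ →
          let i , b≡ , H′ , S⇓H′ , f′ = g S∈
          in i , b≡ , H′ , S⇓H′ ,
             Sim-≼ (⇓-Settled S⇓H′ (send-Valid (Settled.valid st) S∈)) (rs i) (leaf f′)
  Sim-≼ {p} st (expand {p = q} {r} {ne} rs) (leaf f) | no _ | yes refl with Follows-recv ne st f
  ...   | bs , refl , ch , g = recv ch λ i →
          let S , S∈ , H′ , S⇓H′ , f′ = g i
          in S , S∈ , H′ , S⇓H′ ,
             Sim-≼ (⇓-Settled S⇓H′ (recv-Valid (Settled.valid st) S∈)) (rs i) (leaf f′)
  Sim-≼ (settled _ v) (comm rs) (send g) = send λ S∈ →
    let i , b≡ , H′ , S⇓H′ , s = g S∈
    in i , b≡ , H′ , S⇓H′ , Sim-≼ (⇓-Settled S⇓H′ (send-Valid v S∈)) (rs i) s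
  Sim-≼ (settled _ v) (comm rs) (recv ch g) = recv ch λ i →
    let S , S∈ , H′ , S⇓H′ , s = g i
    in S , S∈ , H′ , S⇓H′ , Sim-≼ (⇓-Settled S⇓H′ (recv-Valid v S∈)) (rs i) s
  Sim-≼ st (comm rs) (other p≢q p≢r f) = other p≢q p≢r λ i → Sim-≼ st (rs i) (f i)
  Sim-≼ (settled _ v) (enroute r) (arrive S∈ S⇓H s) =
    arrive S∈ S⇓H (Sim-≼ (⇓-Settled S⇓H (recv-Valid v S∈)) r s)
  Sim-≼ st (enroute r) (pass p≢r s) = pass p≢r (Sim-≼ st r s)

  Pending-≼ : ∀ {p q τ t u} → t ≼ u → Pending p q τ t → Pending p q τ u
  Pending-≼ leaf        leaf        = leaf
  Pending-≼ (unroll r)  leaf        = Pending-≼ r leaf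
  Pending-≼ (expand rs) leaf        = comm (λ _ _ → refl) λ i → Pending-≼ (rs i) leaf
  Pending-≼ (comm rs)   (comm e f)  = comm e λ i → Pending-≼ (rs i) (f i)
  Pending-≼ (enroute r) (here x)    = here (Pending-≼ r x)
  Pending-≼ (enroute r) (there n x) = there n (Pending-≼ r x)

  -- The counterpart of `Reaches` on trees: no path runs into a leaf before the next communication
  -- of `p`.
  data Visible (p : Role) : Tree → Set where
    sender   : ∀ {q ne} {ms : Vec Message (suc k)} {ts} → Visible p (comm p q ne ms ts)
    receiver : ∀ {q ne} {ms : Vec Message (suc k)} {ts} → Visible p (comm q p ne ms ts)
    comm     : ∀ {q r ne} {ms : Vec Message (suc k)} {ts} → p ≢ q → p ≢ r →
               (∀ i → Visible p (ts i)) → Visible p (comm q r ne ms ts)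
    arrive   : ∀ {q b t} → Visible p (enroute q p b t)
    pass     : ∀ {q r b t} → p ≢ r → Visible p t → Visible p (enroute q r b t)

  expose-leaf : ∀ {p} {G : GType 0} (pr : Proper G) → Reaches p d G →
                ∃[ t ] leaf G pr ≼ t × Visible p t
  expose-leaf (comm ne ps) sender   =
    comm _ _ ne _ _ , expand (λ i → ≼-refl (leaf _ (ps i))) , sender
  expose-leaf (comm ne ps) receiver =
    comm _ _ ne _ _ , expand (λ i → ≼-refl (leaf _ (ps i))) , receiver
  expose-leaf (comm ne ps) (comm p≢q p≢r f) =
    let g = λ i → expose-leaf (ps i) (f i)
    in comm _ _ ne _ (proj₁ ∘ g) , expand (λ i → proj₁ (proj₂ (g i))) ,
       comm p≢q p≢r (λ i → proj₂ (proj₂ (g i)))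
  expose-leaf pr@(μ _) (μ r) =
    let t , l , v = expose-leaf (Proper-unfold pr) (Reaches-sub r) in t , unroll l , v

  expose : ∀ {p H t} → Active H → Sim p H t → ∃[ u ] t ≼ u × Visible p u
  expose a (leaf {pr = pr} f) = expose-leaf pr (proj₂ (Follows-reaches a f))
  expose a s@(send {ne = ne} {ms} {ts} _) = _ , ≼-refl (comm _ _ ne ms ts) , sender
  expose a s@(recv {ne = ne} {ms} {ts} _ _) = _ , ≼-refl (comm _ _ ne ms ts) , receiver
  expose a (other {ne = ne} p≢q p≢r f) =
    let g = λ i → expose a (f i)
    in comm _ _ ne _ (proj₁ ∘ g) , comm (λ i → proj₁ (proj₂ (g i))) ,
       comm p≢q p≢r (λ i → proj₂ (proj₂ (g i)))
  expose a (arrive {t = t} _ _ _) = _ , ≼-refl (enroute _ _ _ t) , arrive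
  expose a (pass p≢r s) = let u , l , v = expose a s in enroute _ _ _ u , enroute l , pass p≢r v

  -- Actions on trees

  subject : Action → Role
  subject (p & q ∶ b) = p
  subject (p ⊕ q ∶ b) = p
  subject (cr p)      = p
  subject (det p q)   = p

  -- Below a communication of other roles the action happens in all branches, each at an index of
  -- its own; only the action must agree. An `enroute` node blocks its receiver alone, since its
  -- sender is already past it.
  data Trans (α : Action) : Tree → Tree → Set where
    sent     : ∀ {p q b ne i} {ms : Vec Message (suc k)} {ts} → α ≡ p ⊕ q ∶ b →
               lookup ms i ≡ b → Trans α (comm p q ne ms ts) (enroute p q b (ts i))
    received : ∀ {p q b t} → α ≡ p & q ∶ b → Trans α (enroute q p b t) t
    detected : ∀ {p q ne i} {ms : Vec Message (suc k)} {ts} → α ≡ det q p →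
               lookup ms i ≡ crash → Trans α (comm p q ne ms ts) (ts i)
    crashed  : ∀ {p t} → α ≡ cr p → Trans α t t
    comm     : ∀ {x y ne} {ms : Vec Message (suc k)} {ts us} →
               subject α ≢ x → subject α ≢ y → (∀ i → Trans α (ts i) (us i)) →
               Trans α (comm x y ne ms ts) (comm x y ne ms us)
    enroute  : ∀ {x y b t u} → subject α ≢ y → Trans α t u →
               Trans α (enroute x y b t) (enroute x y b u)

  -- The view of a role that does not act. Detection removes a communication whose sender never
  -- sent, which is incompatible with that sender still following the tree; hence the second
  -- premise.
  Sim-Trans : ∀ {α r H t u} → subject α ≢ r → (∀ q → α ≢ det q r) → Trans α t u →
              Sim r H t → Sim r H u
  Sim-Trans α≢r _ (sent refl refl) (send _) = contradiction refl α≢r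
  Sim-Trans α≢r _ (sent {i = i} refl refl) (recv _ f) =
    let S , S∈ , H , S⇓H , s = f i in arrive S∈ S⇓H s
  Sim-Trans α≢r _ (sent {i = i} refl refl) (other _ r≢q f) = pass r≢q (f i)
  Sim-Trans α≢r _ (received refl) (arrive _ _ _) = contradiction refl α≢r
  Sim-Trans α≢r _ (received refl) (pass _ s) = s
  Sim-Trans _ α≢det (detected refl _) (send _) = contradiction refl (α≢det _)
  Sim-Trans α≢r _ (detected refl _) (recv _ _) = contradiction refl α≢r
  Sim-Trans _ _ (detected {i = i} refl _) (other _ _ f) = f i
  Sim-Trans _ _ (crashed _) s = s
  Sim-Trans α≢r α≢det (comm _ _ us) (send f) = send λ S∈ →
    let i , b≡ , H , S⇓H , s = f S∈ in i , b≡ , H , S⇓H , Sim-Trans α≢r α≢det (us i) s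
  Sim-Trans α≢r α≢det (comm _ _ us) (recv ch f) = recv ch λ i →
    let S , S∈ , H , S⇓H , s = f i in S , S∈ , H , S⇓H , Sim-Trans α≢r α≢det (us i) s
  Sim-Trans α≢r α≢det (comm _ _ us) (other r≢x r≢y f) =
    other r≢x r≢y λ i → Sim-Trans α≢r α≢det (us i) (f i)
  Sim-Trans α≢r α≢det (enroute _ u) (arrive S∈ S⇓H s) =
    arrive S∈ S⇓H (Sim-Trans α≢r α≢det u s)
  Sim-Trans α≢r α≢det (enroute _ u) (pass r≢y s) = pass r≢y (Sim-Trans α≢r α≢det u s)

  Pending-empty : ∀ {p q τ ne} {ms : Vec Message (suc k)} {ts} →
                  Pending p q τ (comm p q ne ms ts) → τ ≡ []
  Pending-empty (comm e _) = e refl refl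

  Untouched : Role → Role → Action → Set
  Untouched p q α = (∀ b → α ≢ p ⊕ q ∶ b) × (∀ b → α ≢ q & p ∶ b)

  Pending-untouched : ∀ {α p q τ t u} → Untouched p q α → Trans α t u →
                      Pending p q τ t → Pending p q τ u
  Pending-untouched (α≢⊕ , _) (sent {i = i} refl _) (comm _ f) =
    there (λ { (refl , refl) → α≢⊕ _ refl }) (f i)
  Pending-untouched (_ , α≢&) (received refl) (here _)    = contradiction refl (α≢& _)
  Pending-untouched _         (received refl) (there _ x) = x
  Pending-untouched _ (detected {i = i} _ _) (comm _ f)   = f i
  Pending-untouched _ (crashed _) x                       = x
  Pending-untouched un (comm _ _ us) (comm e f) = comm e λ i → Pending-untouched un (us i) (f i)
  Pending-untouched un (enroute _ u) (here x)   = here (Pending-untouched un u x)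
  Pending-untouched un (enroute _ u) (there n x) = there n (Pending-untouched un u x)

  Pending-sent : ∀ {p q b τ t u} → Trans (p ⊕ q ∶ b) t u → Pending p q τ t →
                 Pending p q (τ ∷ʳ b) u
  -- An unstarted communication from `p` to `q` has no such message below it, so the new message is
  -- both first and last.
  Pending-sent (sent {i = i} refl _) (comm e f) with e refl refl
  ... | refl = here (f i)
  Pending-sent (received ()) _
  Pending-sent (detected () _) _
  Pending-sent (crashed ()) _
  Pending-sent (comm p≢x _ us) (comm _ f) =
    comm (λ x≡p → contradiction (sym x≡p) p≢x) λ i → Pending-sent (us i) (f i)
  Pending-sent (enroute _ u) (here x)    = here (Pending-sent u x)
  Pending-sent (enroute _ u) (there n x) = there n (Pending-sent u x)

  Pending-received : ∀ {p q b τ t u} → Trans (p & q ∶ b) t u → Pending q p (b ∷ τ) t →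
                     Pending q p τ u
  Pending-received (sent () _) _
  Pending-received (received refl) (here x)    = x
  Pending-received (received refl) (there n _) = contradiction (refl , refl) n
  Pending-received (detected () _) _
  Pending-received (crashed ()) _
  Pending-received (comm _ p≢y us) (comm _ f) =
    comm (λ _ y≡p → contradiction (sym y≡p) p≢y) λ i → Pending-received (us i) (f i)
  Pending-received (enroute p≢y u) (here x)    = contradiction refl p≢y
  Pending-received (enroute _ u) (there n x) = there n (Pending-received u x)

  -- `H` is fixed beforehand because each branch below an `other` node brings its own head normal
  -- form of the continuation; determinism of unfolding makes them agree.
  send-Trans : ∀ {p q bs b S H t} → Visible p t → Sim p (send q bs) t → (b , S) ∈ bs → S ⇓ H →
               ∃[ u ] Trans (p ⊕ q ∶ b) t u × Sim p H u
  send-Trans v (send {ne = ne} f) S∈ S⇓H with f S∈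
  ... | i , refl , H , S⇓K , s with ⇓-deterministic S⇓K S⇓H
  ... | refl = _ , sent refl refl , pass ne s
  send-Trans sender (other p≢p _ _) S∈ S⇓H   = contradiction refl p≢p
  send-Trans receiver (other _ p≢p _) S∈ S⇓H = contradiction refl p≢p
  send-Trans (comm _ _ vs) (other p≢x p≢y f) S∈ S⇓H =
    let g = λ i → send-Trans (vs i) (f i) S∈ S⇓H
    in comm _ _ _ _ (proj₁ ∘ g) , comm p≢x p≢y (λ i → proj₁ (proj₂ (g i))) ,
       other p≢x p≢y (λ i → proj₂ (proj₂ (g i)))
  send-Trans arrive (pass p≢p _) S∈ S⇓H = contradiction refl p≢p
  send-Trans (pass _ v) (pass p≢y s) S∈ S⇓H =
    let u , tr , s′ = send-Trans v s S∈ S⇓H in enroute _ _ _ u , enroute p≢y tr , pass p≢y s′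

  -- A nonempty queue is never pending at a leaf, so `Pending` leads down to the message. The
  -- premise on `bs` makes the branches agree on the continuation.
  receive-Trans : ∀ {p q bs b S H τ t} → Sim p (recv q bs) t → Pending q p (b ∷ τ) t →
                  (∀ {T} → (b , T) ∈ bs → T ≡ S) → S ⇓ H →
                  ∃[ u ] Trans (p & q ∶ b) t u × Sim p H u
  receive-Trans (recv _ _) (comm e _) _ _ = contradiction (e refl refl) λ ()
  receive-Trans (other p≢x p≢y f) (comm _ g) fun S⇓H =
    let h = λ i → receive-Trans (f i) (g i) fun S⇓H
    in comm _ _ _ _ (proj₁ ∘ h) , comm p≢x p≢y (λ i → proj₁ (proj₂ (h i))) ,
       other p≢x p≢y (λ i → proj₂ (proj₂ (h i)))
  receive-Trans (arrive T∈ T⇓K s) (here _) fun S⇓H with fun T∈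
  ... | refl with ⇓-deterministic T⇓K S⇓H
  ... | refl = _ , received refl , s
  receive-Trans (arrive _ _ _) (there n _) _ _ = contradiction (refl , refl) n
  receive-Trans (pass p≢p _) (here _) _ _ = contradiction refl p≢p
  receive-Trans (pass p≢y s) (there _ x) fun S⇓H =
    let u , tr , s′ = receive-Trans s x fun S⇓H in enroute _ _ _ u , enroute p≢y tr , pass p≢y s′

  -- With nothing pending from `q`, the visible communication of `p` is one that `q` has not
  -- started, and as `q` is unreliable, projection has forced a crash branch there.
  detect-Trans : ∀ {p q bs S H t} → ¬ R q → Visible p t → Sim p (recv q bs) t →
                 Pending q p [] t → (∀ {T} → (crash , T) ∈ bs → T ≡ S) → S ⇓ H →
                 ∃[ u ] Trans (det p q) t u × Sim p H u
  detect-Trans ¬Rq _ (recv ch f) _ fun S⇓H with ch ¬Rq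
  ... | i , c with f i
  ... | T , T∈ , K , T⇓K , s with fun (subst (λ b → (b , T) ∈ _) c T∈)
  ... | refl with ⇓-deterministic T⇓K S⇓H
  ... | refl = _ , detected refl c , s
  detect-Trans _ sender (other p≢p _ _) _ _ _   = contradiction refl p≢p
  detect-Trans _ receiver (other _ p≢p _) _ _ _ = contradiction refl p≢p
  detect-Trans ¬Rq (comm _ _ vs) (other p≢x p≢y f) (comm _ g) fun S⇓H =
    let h = λ i → detect-Trans ¬Rq (vs i) (f i) (g i) fun S⇓H
    in comm _ _ _ _ (proj₁ ∘ h) , comm p≢x p≢y (λ i → proj₁ (proj₂ (h i))) ,
       other p≢x p≢y (λ i → proj₂ (proj₂ (h i)))
  detect-Trans _ _ (arrive _ _ _) (there n _) _ _ = contradiction (refl , refl) n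
  detect-Trans _ arrive (pass p≢p _) _ _ _ = contradiction refl p≢p
  detect-Trans ¬Rq (pass _ v) (pass p≢y s) (there _ x) fun S⇓H =
    let u , tr , s′ = detect-Trans ¬Rq v s x fun S⇓H
    in enroute _ _ _ u , enroute p≢y tr , pass p≢y s′

  Pending-head-∈ : ∀ {p q bs b τ t} → Sim p (recv q bs) t → Pending q p (b ∷ τ) t →
                   ∃[ S ] (b , S) ∈ bs
  Pending-head-∈ (recv _ _) (comm e _) = contradiction (e refl refl) λ ()
  Pending-head-∈ (other _ _ f) (comm _ g) = Pending-head-∈ (f zero) (g zero)
  Pending-head-∈ (arrive S∈ _ _) (here _) = _ , S∈
  Pending-head-∈ (arrive _ _ _) (there n _) = contradiction (refl , refl) n
  Pending-head-∈ (pass p≢p _) (here _) = contradiction refl p≢p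
  Pending-head-∈ (pass _ s) (there _ x) = Pending-head-∈ s x

  crash-∈ : ∀ {p q bs t} → ¬ R q → Visible p t → Sim p (recv q bs) t → Pending q p [] t →
            ∃[ S ] (crash , S) ∈ bs
  crash-∈ ¬Rq _ (recv ch f) _ =
    let i , c = ch ¬Rq
        S , S∈ , _ = f i
    in S , subst (λ b → (b , S) ∈ _) c S∈
  crash-∈ _ sender (other p≢p _ _) _   = contradiction refl p≢p
  crash-∈ _ receiver (other _ p≢p _) _ = contradiction refl p≢p
  crash-∈ ¬Rq (comm _ _ vs) (other _ _ f) (comm _ g) = crash-∈ ¬Rq (vs zero) (f zero) (g zero)
  crash-∈ _ _ (arrive _ _ _) (there n _) = contradiction (refl , refl) n
  crash-∈ _ arrive (pass p≢p _) _ = contradiction refl p≢p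
  crash-∈ ¬Rq (pass _ v) (pass _ s) (there _ x) = crash-∈ ¬Rq v s x

  Sim-not-stop : ∀ {p t} → ¬ Sim p stop t
  Sim-not-stop (leaf f)      = Follows-not-stop f
  Sim-not-stop (other _ _ f) = Sim-not-stop (f zero)
  Sim-not-stop (pass _ s)    = Sim-not-stop s

  -- The invariant on configurations

  -- H is the unfolding of the type of p; a role without a type counts as ended.
  data At (Γ : Ctx) (p : Role) : LType 0 → Set where
    some : ∀ {S H} → Γ p ≡ just S → S ⇓ H → At Γ p H
    none : Γ p ≡ nothing → At Γ p end

  At-Hnf : ∀ {Γ p H} → At Γ p H → Hnf H
  At-Hnf (some _ S⇓H) = ⇓-Hnf S⇓H
  At-Hnf (none _)     = end

  At-just : ∀ {Γ p H S} → At Γ p H → Γ p ≡ just S → S ⇓ H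
  At-just (some eq S⇓H) eq′ with trans (sym eq) eq′
  ... | refl = S⇓H
  At-just (none eq) eq′ = contradiction (trans (sym eq) eq′) λ ()

  -- Each queue is described at its receiver, so messages of a sender that has since crashed remain
  -- accounted for. `¬ R p` is stored because crash branches are guaranteed only for unreliable
  -- senders.
  data RoleInv (c : Config) (t : Tree) (p : Role) : Set₁ where
    stopped : proj₁ c p ≡ just stop → ¬ R p → (∀ q → proj₂ c q p ≡ ⊘) → RoleInv c t p
    alive   : ∀ {H} → At (proj₁ c) p H → Valid H → Sim p H t →
              (∀ q → ∃[ τ ] proj₂ c q p ≡ avail τ × Pending q p τ t) → RoleInv c t p

  Inv : Config → Tree → Set₁
  Inv c t = ∀ p → RoleInv c t p

  At-≗ : ∀ {Γ Γ′ p H} → Γ′ p ≡ Γ p → At Γ p H → At Γ′ p H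
  At-≗ eq (some e S⇓H) = some (trans eq e) S⇓H
  At-≗ eq (none e)     = none (trans eq e)

  Inv-≈ᶜ : ∀ {c c′ t} → c′ ≈ᶜ c → Inv c t → Inv c′ t
  Inv-≈ᶜ (Γ≗ , Δ≗) inv p with inv p
  ... | stopped e ¬Rp ⊘s = stopped (trans (Γ≗ p) e) ¬Rp λ q → trans (Δ≗ q p) (⊘s q)
  ... | alive at v s qs = alive (At-≗ (Γ≗ p) at) v s λ q →
          let τ , e , x = qs q in τ , trans (Δ≗ q p) e , x

  At-Settled : ∀ {Γ p H} → At Γ p H → Valid H → Settled H
  At-Settled at v = settled (At-Hnf at) v

  Inv-≼ : ∀ {c t u} → t ≼ u → Inv c t → Inv c u
  Inv-≼ l inv p with inv p
  ... | stopped e ¬Rp ⊘s = stopped e ¬Rp ⊘s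
  ... | alive at v s qs = alive at v (Sim-≼ (At-Settled at v) l s) λ q →
          let τ , e , x = qs q in τ , e , Pending-≼ l x

  ↦-same : ∀ (Γ : Ctx) p T → (Γ [ p ↦ T ]) p ≡ just T
  ↦-same Γ p T with p ≟ p
  ... | yes _  = refl
  ... | no p≢p = contradiction refl p≢p

  ↦-other : ∀ (Γ : Ctx) {p r} T → p ≢ r → (Γ [ p ↦ T ]) r ≡ Γ r
  ↦-other Γ {p} {r} T p≢r with r ≟ p
  ... | yes r≡p = contradiction (sym r≡p) p≢r
  ... | no _    = refl

  ⇒↦-other : ∀ (Δ : QEnv) {p q r s} τ → ¬ (r ≡ p × s ≡ q) → (Δ [ p ⇒ q ↦ τ ]) r s ≡ Δ r s
  ⇒↦-other Δ {p} {q} {r} {s} τ n with r ≟ p | s ≟ q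
  ... | yes r≡p | yes s≡q = contradiction (r≡p , s≡q) n
  ... | no _    | _       = refl
  ... | yes _   | no _    = refl

  ↦⊘-same : ∀ (Δ : QEnv) p q → (Δ [·, p ↦⊘]) q p ≡ ⊘
  ↦⊘-same Δ p q with p ≟ p
  ... | yes _  = refl
  ... | no p≢p = contradiction refl p≢p

  ↦⊘-other : ∀ (Δ : QEnv) {p r} q → p ≢ r → (Δ [·, p ↦⊘]) q r ≡ Δ q r
  ↦⊘-other Δ {p} {r} q p≢r with r ≟ p
  ... | yes r≡p = contradiction (sym r≡p) p≢r
  ... | no _    = refl

  At-↦-other : ∀ {Γ p r H T} → p ≢ r → At Γ r H → At (Γ [ p ↦ T ]) r H
  At-↦-other {Γ} p≢r = At-≗ (↦-other Γ _ p≢r)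

  Inv-unfold : ∀ {Γ Δ p T t} → Γ p ≡ just (μ T) → Inv (Γ , Δ) t →
               Inv (Γ [ p ↦ unfoldL T ] , Δ) t
  Inv-unfold {Γ} {p = p} {T} eq inv r with p ≟ r | inv r
  ... | yes refl | stopped e _ _ = contradiction (trans (sym e) eq) λ ()
  ... | yes refl | alive at v s qs with At-just at eq
  ...   | unfold _ h = alive (some (↦-same Γ p _) h) v s qs
  Inv-unfold {Γ} eq inv r | no p≢r | stopped e ¬Rr ⊘s =
    stopped (trans (↦-other Γ _ p≢r) e) ¬Rr ⊘s
  Inv-unfold eq inv r | no p≢r | alive at v s qs = alive (At-↦-other p≢r at) v s qs

  At-not-stop : ∀ {Γ p H t} → At Γ p H → Sim p H t → Γ p ≢ just stop
  At-not-stop at s eq with At-just at eq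
  ... | done _ = Sim-not-stop s

  -- Preservation of the invariant under reductions

  Evolves : Action → Tree → Config → Set₁
  Evolves α t c = ∃[ u ] ∃[ v ] t ≼ u × Trans α u v × Inv c v

  Queues : QEnv → Role → Tree → Set
  Queues Δ r t = ∀ x → ∃[ τ ] Δ x r ≡ avail τ × Pending x r τ t

  Queues-≼ : ∀ Δ {r t u} → t ≼ u → Queues Δ r t → Queues Δ r u
  Queues-≼ Δ l qs x = let τ , e , y = qs x in τ , e , Pending-≼ l y

  Queues-sent : ∀ Δ {p q b t u r} → Trans (p ⊕ q ∶ b) t u → Queues Δ r t →
                Queues (Δ [ p ⇒ q ↦ Δ p q · b ]) r u
  Queues-sent Δ {p} {q} {r = r} tr qs x with qs x | x ≟ p | r ≟ q
  ... | τ , e , y | yes refl | yes refl rewrite e = _ , refl , Pending-sent tr y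
  ... | τ , e , y | no x≢p   | _       =
        τ , e , Pending-untouched ((λ { _ refl → x≢p refl }) , λ _ ()) tr y
  ... | τ , e , y | yes _    | no r≢q  =
        τ , e , Pending-untouched ((λ { _ refl → r≢q refl }) , λ _ ()) tr y

  Queues-received : ∀ Δ {p q b τ t u r} → Δ q p ≡ avail (b ∷ τ) → Trans (p & q ∶ b) t u →
                    Queues Δ r t → Queues (Δ [ q ⇒ p ↦ avail τ ]) r u
  Queues-received Δ {p} {q} {r = r} eq tr qs x with qs x | x ≟ q | r ≟ p
  ... | τ , e , y | yes refl | yes refl with trans (sym eq) e
  ...   | refl = _ , refl , Pending-received tr y
  Queues-received Δ eq tr qs x | τ , e , y | no x≢q | _ =
    τ , e , Pending-untouched ((λ _ ()) , λ { _ refl → x≢q refl }) tr y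
  Queues-received Δ eq tr qs x | τ , e , y | yes _ | no r≢p =
    τ , e , Pending-untouched ((λ _ ()) , λ { _ refl → r≢p refl }) tr y

  Queues-detected : ∀ Δ {p q t u r} → Trans (det p q) t u → Queues Δ r t → Queues Δ r u
  Queues-detected Δ tr qs x =
    let τ , e , y = qs x in τ , e , Pending-untouched ((λ _ ()) , λ _ ()) tr y

  ⊘-sent : ∀ (Δ : QEnv) {p q b r} → (∀ x → Δ x r ≡ ⊘) →
           ∀ x → (Δ [ p ⇒ q ↦ Δ p q · b ]) x r ≡ ⊘
  ⊘-sent Δ {p} {q} {b} {r} ⊘s x with x ≟ p | r ≟ q
  ... | yes refl | yes refl = cong (_· b) (⊘s x)
  ... | no _     | _        = ⊘s x
  ... | yes _    | no _     = ⊘s x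

  step-send : ∀ {Γ Δ p q bs b S t} → Γ p ≡ just (send q bs) → (b , S) ∈ bs → Inv (Γ , Δ) t →
              Evolves (p ⊕ q ∶ b) t (Γ [ p ↦ S ] , Δ [ p ⇒ q ↦ Δ p q · b ])
  step-send {Γ} {Δ} {p} {q} {bs} {b} {S} {t} eq S∈ inv with inv p
  ... | stopped e _ _ = contradiction (trans (sym e) eq) λ ()
  ... | alive at v s qs with At-just at eq
  ...   | done _ =
          let H , S⇓H    = Valid-⇓ (send-Valid v S∈)
              u , l , vis = expose send s
              w , tr , s′ = send-Trans vis (Sim-≼ (At-Settled at v) l s) S∈ S⇓H
          in u , w , l , tr , inv′ l tr S⇓H s′
    where
    inv′ : ∀ {u w H} → t ≼ u → Trans (p ⊕ q ∶ b) u w → S ⇓ H → Sim p H w →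
           Inv (Γ [ p ↦ S ] , Δ [ p ⇒ q ↦ Δ p q · b ]) w
    inv′ l tr S⇓H s′ r with p ≟ r
    ... | yes refl = alive (some (↦-same Γ p _) S⇓H) (⇓-Valid S⇓H (send-Valid v S∈)) s′
                           (Queues-sent Δ tr (Queues-≼ Δ l qs))
    ... | no p≢r with inv r
    ...   | stopped e ¬Rr ⊘s = stopped (trans (↦-other Γ _ p≢r) e) ¬Rr (⊘-sent Δ ⊘s)
    ...   | alive at v s qs = alive (At-↦-other p≢r at) v
              (Sim-Trans p≢r (λ _ ()) tr (Sim-≼ (At-Settled at v) l s))
              (Queues-sent Δ tr (Queues-≼ Δ l qs))

  step-receive : ∀ {Γ Δ p q bs b S τ t} → Γ p ≡ just (recv q bs) → (b , S) ∈ bs →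
                 Δ q p ≡ avail (b ∷ τ) → Inv (Γ , Δ) t →
                 Evolves (p & q ∶ b) t (Γ [ p ↦ S ] , Δ [ q ⇒ p ↦ avail τ ])
  step-receive {Γ} {Δ} {p} {q} {bs} {b} {S} {τ} {t} eq S∈ eqΔ inv with inv p
  ... | stopped e _ _ = contradiction (trans (sym e) eq) λ ()
  ... | alive at v s qs with At-just at eq | qs q
  ...   | done _ | _ , e , x with trans (sym eqΔ) e
  ...     | refl =
          let H , S⇓H    = Valid-⇓ (recv-Valid v S∈)
              w , tr , s′ = receive-Trans s x (λ T∈ → recv-functional v T∈ S∈) S⇓H
          in t , w , ≼-refl t , tr , inv′ tr S⇓H s′
    where
    inv′ : ∀ {w H} → Trans (p & q ∶ b) t w → S ⇓ H → Sim p H w →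
           Inv (Γ [ p ↦ S ] , Δ [ q ⇒ p ↦ avail τ ]) w
    inv′ tr S⇓H s′ r with p ≟ r
    ... | yes refl = alive (some (↦-same Γ p _) S⇓H) (⇓-Valid S⇓H (recv-Valid v S∈)) s′
                           (Queues-received Δ eqΔ tr qs)
    ... | no p≢r with inv r
    ...   | stopped e ¬Rr ⊘s = stopped (trans (↦-other Γ _ p≢r) e) ¬Rr λ x →
              trans (⇒↦-other Δ _ λ { (_ , refl) → p≢r refl }) (⊘s x)
    ...   | alive at v s qs = alive (At-↦-other p≢r at) v
              (Sim-Trans p≢r (λ _ ()) tr s) (Queues-received Δ eqΔ tr qs)

  stopped-unreliable : ∀ {c t p} → Inv c t → proj₁ c p ≡ just stop → ¬ R p
  stopped-unreliable {p = p} inv eq with inv p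
  ... | stopped _ ¬Rp _  = ¬Rp
  ... | alive at _ s _   = contradiction eq (At-not-stop at s)

  step-detect : ∀ {Γ Δ p q bs S t} → Γ q ≡ just (recv p bs) → Γ p ≡ just stop →
                (crash , S) ∈ bs → Δ p q ≡ ε → Inv (Γ , Δ) t →
                Evolves (det q p) t (Γ [ q ↦ S ] , Δ)
  step-detect {Γ} {Δ} {p} {q} {bs} {S} {t} eq eqp S∈ eqΔ inv with inv q
  ... | stopped e _ _ = contradiction (trans (sym e) eq) λ ()
  ... | alive at v s qs with At-just at eq | qs p
  ...   | done _ | _ , e , x with trans (sym eqΔ) e
  ...     | refl =
          let H , S⇓H    = Valid-⇓ (recv-Valid v S∈)
              u , l , vis = expose recv s
              w , tr , s′ = detect-Trans (stopped-unreliable inv eqp) vis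
                              (Sim-≼ (At-Settled at v) l s) (Pending-≼ l x)
                              (λ T∈ → recv-functional v T∈ S∈) S⇓H
          in u , w , l , tr , inv′ l tr S⇓H s′
    where
    inv′ : ∀ {u w H} → t ≼ u → Trans (det q p) u w → S ⇓ H → Sim q H w →
           Inv (Γ [ q ↦ S ] , Δ) w
    inv′ l tr S⇓H s′ r with q ≟ r
    ... | yes refl = alive (some (↦-same Γ q _) S⇓H) (⇓-Valid S⇓H (recv-Valid v S∈)) s′
                           (Queues-detected Δ tr (Queues-≼ Δ l qs))
    ... | no q≢r with inv r
    ...   | stopped e ¬Rr ⊘s = stopped (trans (↦-other Γ _ q≢r) e) ¬Rr ⊘s
    ...   | alive at v s qs = alive (At-↦-other q≢r at) v
              -- A role that is alive is not the one whose crash is detected.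
              (Sim-Trans q≢r (λ { _ refl → At-not-stop at s eqp }) tr
                         (Sim-≼ (At-Settled at v) l s))
              (Queues-detected Δ tr (Queues-≼ Δ l qs))

  step-crash : ∀ {Γ Δ p t} → ¬ R p → Inv (Γ , Δ) t →
               Evolves (cr p) t (Γ [ p ↦ stop ] , Δ [·, p ↦⊘])
  step-crash {Γ} {Δ} {p} {t} ¬Rp inv = t , t , ≼-refl t , crashed refl , inv′
    where
    inv′ : Inv (Γ [ p ↦ stop ] , Δ [·, p ↦⊘]) t
    inv′ r with p ≟ r
    ... | yes refl = stopped (↦-same Γ p _) ¬Rp (↦⊘-same Δ p)
    ... | no p≢r with inv r
    ...   | stopped e ¬Rr ⊘s = stopped (trans (↦-other Γ _ p≢r) e) ¬Rr λ q →
              trans (↦⊘-other Δ q p≢r) (⊘s q)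
    ...   | alive at v s qs = alive (At-↦-other p≢r at) v s λ q →
              let τ , e , x = qs q in τ , trans (↦⊘-other Δ q p≢r) e , x

  step-Inv : ∀ {c c′ α t} → c —[ α ]→ c′ → (∀ r → R r → α ≢ cr r) → Inv c t → Evolves α t c′
  step-Inv (send eq S∈ c≈) _ inv =
    let u , w , l , tr , inv′ = step-send eq S∈ inv in u , w , l , tr , Inv-≈ᶜ c≈ inv′
  step-Inv (receive eq S∈ eqΔ c≈) _ inv =
    let u , w , l , tr , inv′ = step-receive eq S∈ eqΔ inv in u , w , l , tr , Inv-≈ᶜ c≈ inv′
  step-Inv (rec eq st) ok inv = step-Inv st ok (Inv-unfold eq inv)
  step-Inv (crash _ _ _ c≈) ok inv =
    let u , w , l , tr , inv′ = step-crash (λ Rp → ok _ Rp refl) inv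
    in u , w , l , tr , Inv-≈ᶜ c≈ inv′
  step-Inv (detect eq eqp S∈ eqΔ c≈) _ inv =
    let u , w , l , tr , inv′ = step-detect eq eqp S∈ eqΔ inv in u , w , l , tr , Inv-≈ᶜ c≈ inv′

  step-∃Inv : ∀ {c c′} → c ⟶[ R ] c′ → ∃[ t ] Inv c t → ∃[ t ] Inv c′ t
  step-∃Inv (_ , ok , st) (_ , inv) = let _ , w , _ , _ , inv′ = step-Inv st ok inv in w , inv′

  -- Safety

  data Unfolds : Config → Config → Set where
    unfolds : ∀ {Γ Δ p T} → Γ p ≡ just (μ T) → Unfolds (Γ , Δ) (Γ [ p ↦ unfoldL T ] , Δ)

  Inv-S1 : ∀ {Γ Δ p q bs t} → Inv (Γ , Δ) t → Γ q ≡ just (recv p bs) →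
           Δ p q ≢ ⊘ → Δ p q ≢ ε → ∃[ b ] Enabled (Γ , Δ) (q & p ∶ b)
  Inv-S1 {p = p} {q} inv eq ≢⊘ ≢ε with inv q
  ... | stopped _ _ ⊘s = contradiction (⊘s p) ≢⊘
  ... | alive at _ s qs with At-just at eq | qs p
  ...   | done _ | [] , e , _    = contradiction e ≢ε
  ...   | done _ | b ∷ τ , e , x =
          b , _ , receive eq (proj₂ (Pending-head-∈ s x)) e ((λ _ → refl) , λ _ _ → refl)

  Inv-S2 : ∀ {Γ Δ p q bs t} → Inv (Γ , Δ) t → Γ p ≡ just stop →
           Γ q ≡ just (recv p bs) → Δ p q ≡ ε → Enabled (Γ , Δ) (det q p)
  Inv-S2 {p = p} {q} inv eqp eq eqΔ with inv q
  ... | stopped e _ _ = contradiction (trans (sym e) eq) λ ()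
  ... | alive at v s qs with At-just at eq | qs p
  ...   | done _ | _ , e , x with trans (sym eqΔ) e
  ...     | refl =
          let u , l , vis = expose recv s
              S , S∈ = crash-∈ (stopped-unreliable inv eqp) vis
                         (Sim-≼ (At-Settled at v) l s) (Pending-≼ l x)
          in _ , detect eq eqp S∈ eqΔ ((λ _ → refl) , λ _ _ → refl)

  -- Reachability rather than Inv is the safety property, for its level.
  Inv-Safe : ∀ {c t} → Inv c t → Safe R c
  Inv-Safe {c} inv = Star _↝_ c , record
    { S1 = λ c↝* → Inv-S1 (proj₂ (reachable c↝*))
    ; S2 = λ c↝* → Inv-S2 (proj₂ (reachable c↝*))
    ; S3 = λ c↝* eq → c↝* ◅◅ (inj₂ (unfolds eq) ◅ ε*)
    ; S4 = λ c↝* st → c↝* ◅◅ (inj₁ st ◅ ε*)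
    } , ε*
    where
    _↝_ : Config → Config → Set
    c ↝ c′ = c ⟶[ R ] c′ ⊎ Unfolds c c′

    go : ∀ {c c′} → Star _↝_ c c′ → ∃[ t ] Inv c t → ∃[ t ] Inv c′ t
    go ε*                       inv       = inv
    go (inj₁ st ◅ st*)          inv       = go st* (step-∃Inv st inv)
    go (inj₂ (unfolds eq) ◅ st*) (t , inv) = go st* (t , Inv-unfold eq inv)

    reachable : ∀ {c′} → Star _↝_ c c′ → ∃[ t ] Inv c′ t
    reachable st* = go st* (_ , inv)

  reachable-Inv : ∀ {c c′ t} → c ⟶*[ R ] c′ → Inv c t → ∃[ t ] Inv c′ t
  reachable-Inv ε*         inv = _ , inv
  reachable-Inv (st ◅ st*) inv = reachable-Inv st* (proj₂ (step-∃Inv st (_ , inv)))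

  -- Liveness and deadlock-freedom

  -- A communication weighs more than the transmission it turns into, so that
  -- every action at the root lowers the weight.
  data Next (s r : Role) : ℕ → Tree → Set where
    arrive  : ∀ {b t} → Next s r n (enroute s r b t)
    meet    : ∀ {ne} {ms : Vec Message (suc k)} {ts} → Next s r (suc n) (comm s r ne ms ts)
    comm    : ∀ {x y ne} {ms : Vec Message (suc k)} {ts} →
              (∀ i → Next s r n (ts i)) → Next s r (suc (suc n)) (comm x y ne ms ts)
    enroute : ∀ {x y b t} → Next s r n t → Next s r (suc n) (enroute x y b t)

  Next-suc : ∀ {s r t} → Next s r n t → Next s r (suc n) t
  Next-suc arrive      = arrive
  Next-suc meet        = meet
  Next-suc (comm f)    = comm λ i → Next-suc (f i)
  Next-suc (enroute x) = enroute (Next-suc x)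

  Next-≼ : ∀ {s r t u} → t ≼ u → Next s r n t → Next s r n u
  Next-≼ (comm rs)   meet        = meet
  Next-≼ (comm rs)   (comm f)    = comm λ i → Next-≼ (rs i) (f i)
  Next-≼ (enroute l) arrive      = arrive
  Next-≼ (enroute l) (enroute x) = enroute (Next-≼ l x)

  Visible-Next : ∀ {p q bs t} → Visible p t → Sim p (recv q bs) t → ∃[ n ] Next q p n t
  Visible-Next _        (recv _ _)      = 1 , meet
  Visible-Next sender   (other p≢p _ _) = contradiction refl p≢p
  Visible-Next receiver (other _ p≢p _) = contradiction refl p≢p
  Visible-Next (comm _ _ vs) (other _ _ f) =
    let n , x = uniform-bound _ Next-suc (λ i → Visible-Next (vs i) (f i)) in _ , comm x
  Visible-Next _      (arrive _ _ _) = 0 , arrive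
  Visible-Next arrive (pass p≢p _)   = contradiction refl p≢p
  Visible-Next (pass _ v) (pass _ s) = let n , x = Visible-Next v s in suc n , enroute x

  Pending-Next : ∀ {p q b τ t} → Pending p q (b ∷ τ) t → ∃[ n ] Next p q n t
  Pending-Next (comm _ f)  =
    let n , x = uniform-bound _ Next-suc (λ i → Pending-Next (f i)) in _ , comm x
  Pending-Next (here _)    = 0 , arrive
  Pending-Next (there _ x) = let n , y = Pending-Next x in suc n , enroute y

  data Goal (s r : Role) : Action → Set where
    receives : ∀ {b} → Goal s r (r & s ∶ b)
    detects  : Goal s r (det r s)

  goal? : ∀ s r α → Dec (Goal s r α)
  goal? s r (p & q ∶ b) with p ≟ r | q ≟ s
  ... | yes refl | yes refl = yes receives
  ... | no p≢r   | _        = no λ { receives → p≢r refl }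
  ... | yes _    | no q≢s   = no λ { receives → q≢s refl }
  goal? s r (p ⊕ q ∶ b) = no λ ()
  goal? s r (cr p)      = no λ ()
  goal? s r (det p q) with p ≟ r | q ≟ s
  ... | yes refl | yes refl = yes detects
  ... | no p≢r   | _        = no λ { detects → p≢r refl }
  ... | yes _    | no q≢s   = no λ { detects → q≢s refl }

  Next-Trans : ∀ {α s r t u} → ¬ Goal s r α → Trans α t u → Next s r n t → Next s r n u
  Next-Trans _  (sent _ _)     meet        = arrive
  Next-Trans _  (sent _ _)     (comm f)    = enroute (Next-suc (f _))
  Next-Trans ¬g (received refl) arrive     = contradiction receives ¬g
  Next-Trans _  (received _)   (enroute x) = Next-suc x
  Next-Trans ¬g (detected refl _) meet     = contradiction detects ¬g
  Next-Trans _  (detected _ _) (comm f)    = Next-suc (Next-suc (f _))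
  Next-Trans _  (crashed _)    x           = x
  Next-Trans _  (comm _ _ us)  meet        = meet
  Next-Trans ¬g (comm _ _ us)  (comm f)    = comm λ i → Next-Trans ¬g (us i) (f i)
  Next-Trans _  (enroute _ u)  arrive      = arrive
  Next-Trans ¬g (enroute _ u)  (enroute x) = enroute (Next-Trans ¬g u x)

  -- `sends` leaves the message open, since fairness of sending promises some message from `x` to
  -- `y`, not a particular one.
  data RootAction : Tree → Action → Set where
    sends    : ∀ {x y ne b} {ms : Vec Message (suc k)} {ts} →
               RootAction (comm x y ne ms ts) (x ⊕ y ∶ b)
    detects  : ∀ {x y ne} {ms : Vec Message (suc k)} {ts} →
               RootAction (comm x y ne ms ts) (det y x)
    receives : ∀ {x y b t} → RootAction (enroute x y b t) (y & x ∶ b)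

  RootAction-≼ : ∀ {t u α} → t ≼ u → RootAction t α → RootAction u α
  RootAction-≼ (comm _)    sends    = sends
  RootAction-≼ (comm _)    detects  = detects
  RootAction-≼ (enroute _) receives = receives

  RootAction-no-crash : ∀ {t α} → RootAction t α → ∀ p → α ≢ cr p
  RootAction-no-crash sends    _ ()
  RootAction-no-crash detects  _ ()
  RootAction-no-crash receives _ ()

  -- An action at the root replaces the root by something lighter. One below it has a subject that
  -- the root does not block, so it differs from every root action and leaves the root in place.
  advance : ∀ {α β s r t u} → ¬ Goal s r β → Trans β t u → Next s r n t → RootAction t α →
            (∃[ m ] m < n × Next s r m u) ⊎ (RootAction u α × α ≢ β)
  advance _  (sent _ _)        meet        _ = inj₁ (_ , n<1+n _ , arrive)
  advance _  (sent _ _)        (comm f)    _ = inj₁ (_ , n<1+n _ , enroute (f _))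
  advance ¬g (received refl)   arrive      _ = contradiction receives ¬g
  advance _  (received _)      (enroute x) _ = inj₁ (_ , n<1+n _ , x)
  advance ¬g (detected refl _) meet        _ = contradiction detects ¬g
  advance _  (detected _ _)    (comm f)    _ = inj₁ (_ , n<1+n _ , Next-suc (f _))
  advance _ (crashed refl) _ ra = inj₂ (ra , RootAction-no-crash ra _)
  advance _ (comm β≢x _ _) _ sends    = inj₂ (sends , λ { refl → β≢x refl })
  advance _ (comm _ β≢y _) _ detects  = inj₂ (detects , λ { refl → β≢y refl })
  advance _ (enroute β≢y _) _ receives = inj₂ (receives , λ { refl → β≢y refl })

  enabled-send : ∀ {Γ Δ p q bs b S T} → T ⇓ send q bs → Γ p ≡ just T → (b , S) ∈ bs →
                 Enabled (Γ , Δ) (p ⊕ q ∶ b)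
  enabled-send (done _) eq S∈ = _ , send eq S∈ ((λ _ → refl) , λ _ _ → refl)
  enabled-send {Γ} (unfold _ h) eq S∈ =
    let c , st = enabled-send h (↦-same Γ _ _) S∈ in c , rec eq st

  enabled-receive : ∀ {Γ Δ p q bs b S T τ} → T ⇓ recv q bs → Γ p ≡ just T → (b , S) ∈ bs →
                    Δ q p ≡ avail (b ∷ τ) → Enabled (Γ , Δ) (p & q ∶ b)
  enabled-receive (done _) eq S∈ eqΔ = _ , receive eq S∈ eqΔ ((λ _ → refl) , λ _ _ → refl)
  enabled-receive {Γ} (unfold _ h) eq S∈ eqΔ =
    let c , st = enabled-receive h (↦-same Γ _ _) S∈ eqΔ in c , rec eq st

  enabled-detect : ∀ {Γ Δ p q bs S T} → T ⇓ recv q bs → Γ p ≡ just T → Γ q ≡ just stop →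
                   (crash , S) ∈ bs → Δ q p ≡ ε → Enabled (Γ , Δ) (det p q)
  enabled-detect (done _) eq eqq S∈ eqΔ = _ , detect eq eqq S∈ eqΔ ((λ _ → refl) , λ _ _ → refl)
  enabled-detect {Γ} {p = p} {q} (unfold _ h) eq eqq S∈ eqΔ =
    let c , st = enabled-detect h (↦-same Γ _ _) (trans (↦-other Γ _ p≢q) eqq) S∈ eqΔ
    in c , rec eq st
    where
    p≢q : p ≢ q
    p≢q refl with trans (sym eq) eqq
    ... | ()

  -- A sender that is alive can send. A stopped one is unreliable and its queue is empty here, so a
  -- receiver that is alive can detect. If both are stopped, everyone alive follows every branch.
  root-comm : ∀ {c x y ne} {ms : Vec Message (suc k)} {ts} → Inv c (comm x y ne ms ts) →
              (∃[ α ] RootAction (comm x y ne ms ts) α × Enabled c α) ⊎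
              (proj₂ c x y ≡ ⊘ × ∀ i → Inv c (ts i))
  root-comm {x = x} {y} {ne} inv with inv x
  root-comm {ne = ne} inv | alive (some eq h) (send S∈ _) (send _) _ =
    inj₁ (_ , sends , enabled-send h eq S∈)
  root-comm {ne = ne} inv | alive _ _ (recv _ _) _      = contradiction refl ne
  root-comm {ne = ne} inv | alive _ _ (other x≢x _ _) _ = contradiction refl x≢x
  root-comm {x = x} {y} {ne} inv | stopped ex ¬Rx _ with inv y
  root-comm {x = x} {ne = ne} inv | stopped ex ¬Rx _ | alive (some eq h) _ (recv ch f) qs =
    let i , c = ch ¬Rx
        S , S∈ , _ = f i
        τ , eqΔ , z = qs x
    in inj₁ (_ , detects , enabled-detect h eq ex (subst (λ b → (b , S) ∈ _) c S∈)
                             (trans eqΔ (cong avail (Pending-empty z))))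
  root-comm {ne = ne} inv | stopped ex ¬Rx _ | alive _ _ (send _) _        = contradiction refl ne
  root-comm {ne = ne} inv | stopped ex ¬Rx _ | alive _ _ (other _ y≢y _) _ = contradiction refl y≢y
  root-comm {c = c} {x} {y} {ts = ts} inv | stopped ex _ _ | stopped ey _ ⊘s = inj₂ (⊘s x , child)
    where
    child : ∀ i → Inv c (ts i)
    child i p with inv p
    ... | stopped e ¬Rp ⊘s = stopped e ¬Rp ⊘s
    ... | alive at _ s@(send _) _   = contradiction ex (At-not-stop at s)
    ... | alive at _ s@(recv _ _) _ = contradiction ey (At-not-stop at s)
    ... | alive at v (other _ _ f) qs = alive at v (f i) λ q → let τ , e , z = qs q in τ , e , prune z
      where
      prune : ∀ {q τ} → Pending q p τ (comm x y _ _ ts) → Pending q p τ (ts i)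
      prune (comm _ g) = g i

  root-enroute : ∀ {c x y b t} → Inv c (enroute x y b t) →
                 (∃[ α ] RootAction (enroute x y b t) α × Enabled c α) ⊎
                 (proj₂ c x y ≡ ⊘ × Inv c t)
  root-enroute {x = x} {y} inv with inv y
  root-enroute {x = x} inv | alive (some eq h) _ (arrive S∈ _ _) qs with qs x
  ... | _ , eqΔ , here _    = inj₁ (_ , receives , enabled-receive h eq S∈ eqΔ)
  ... | _ , _   , there n _ = contradiction (refl , refl) n
  root-enroute inv | alive _ _ (pass y≢y _) _ = contradiction refl y≢y
  root-enroute {c} {x} {y} {b} {t} inv | stopped ey _ ⊘s = inj₂ (⊘s x , child)
    where
    child : Inv c t
    child p with inv p
    ... | stopped e ¬Rp ⊘s = stopped e ¬Rp ⊘s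
    ... | alive at _ s@(arrive _ _ _) _ = contradiction ey (At-not-stop at s)
    ... | alive at v (pass p≢y s) qs = alive at v s λ q → let τ , e , z = qs q in τ , e , prune z
      where
      prune : ∀ {q τ} → Pending q p τ (enroute x y b t) → Pending q p τ t
      prune (here _)    = contradiction refl p≢y
      prune (there _ z) = z

  -- If no root action is enabled then the root is stale and can be dropped.
  root : ∀ {c s r t} → Inv c t → Next s r n t → proj₂ c s r ≢ ⊘ →
         (∃[ α ] RootAction t α × Enabled c α) ⊎
         (∃[ m ] ∃[ u ] m < n × Next s r m u × Inv c u)
  root inv arrive ≢⊘ with root-enroute inv
  ... | inj₁ x       = inj₁ x
  ... | inj₂ (e , _) = contradiction e ≢⊘
  root inv meet ≢⊘ with root-comm inv
  ... | inj₁ x       = inj₁ x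
  ... | inj₂ (e , _) = contradiction e ≢⊘
  root inv (comm f) _ with root-comm inv
  ... | inj₁ x           = inj₁ x
  -- No role that is alive distinguishes the branches, so any of them will do.
  ... | inj₂ (_ , child) = inj₂ (_ , _ , n<1+n _ , Next-suc (f zero) , child zero)
  root inv (enroute x) _ with root-enroute inv
  ... | inj₁ y           = inj₁ y
  ... | inj₂ (_ , child) = inj₂ (_ , _ , n<1+n _ , x , child)

  progress : ∀ {c s r t} → Acc _<_ n → Inv c t → Next s r n t → proj₂ c s r ≢ ⊘ →
             ∃[ c′ ] c ⟶ c′
  progress (acc rs) inv x ≢⊘ with root inv x ≢⊘
  ... | inj₁ (α , ra , c′ , st)        = c′ , α , RootAction-no-crash ra , st
  ... | inj₂ (_ , _ , m<n , x′ , inv′) = progress (rs m<n) inv′ x′ ≢⊘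

  avail≢⊘ : ∀ {Q : Queue} {τ} → Q ≡ avail τ → Q ≢ ⊘
  avail≢⊘ refl ()

  Sim-Next : ∀ {c t p q bs} → Inv c t → Settled (recv q bs) → Sim p (recv q bs) t →
             ∃[ n ] ∃[ u ] Inv c u × Next q p n u
  Sim-Next inv st s =
    let u , l , vis = expose recv s
        n , x = Visible-Next vis (Sim-≼ st l s)
    in n , u , Inv-≼ l inv , x

  -- A sender moves by itself. A receiver may have to wait, but then the root above its
  -- communication offers an action, once stale roots are dropped.
  Active-progress : ∀ {c t p H} → Inv c t → Active H → At (proj₁ c) p H → Valid H → Sim p H t →
                    (∀ q → ∃[ τ ] proj₂ c q p ≡ avail τ × Pending q p τ t) → ∃[ c′ ] c ⟶ c′
  Active-progress inv send (some eq h) (send S∈ _) _ _ =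
    let c′ , st = enabled-send h eq S∈ in c′ , _ , (λ _ ()) , st
  Active-progress inv (recv {q}) at v s qs =
    let n , u , inv′ , x = Sim-Next inv (At-Settled at v) s
        τ , e , _ = qs q
    in progress (<-wellFounded n) inv′ x (avail≢⊘ e)

  -- A message in transit obliges its receiver to communicate, so a leftover message contradicts
  -- being stuck.
  Pending-Active : ∀ {p q b τ H t} → Pending p q (b ∷ τ) t → Sim q H t → Active H
  Pending-Active _ (send _)       = send
  Pending-Active _ (recv _ _)     = recv
  Pending-Active _ (arrive _ _ _) = recv
  Pending-Active (comm _ f)  (other _ _ g) = Pending-Active (f zero) (g zero)
  Pending-Active (here _)    (pass q≢q _)  = contradiction refl q≢q
  Pending-Active (there _ x) (pass _ s)    = Pending-Active x s

  Inv-DeadlockFree : ∀ {c t} → Inv c t → DeadlockFree R c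
  Inv-DeadlockFree inv = Inv-Safe inv , λ c′ st* stuck →
    let t , inv′ = reachable-Inv st* inv
    in terminated inv′ λ { (c″ , α , ok , st) → stuck (c″ , α , (λ r _ → ok r) , st) }
    where
    terminated : ∀ {c t} → Inv c t → ¬ (∃[ c′ ] c ⟶ c′) → Terminated c
    terminated {c} {t} inv stuck = types , stops , queues
      where
      types : ∀ {p T} → proj₁ c p ≡ just T → T ≡ end ⊎ T ≡ stop
      types {p} eq with inv p
      ... | stopped e _ _ with trans (sym e) eq
      ...   | refl = inj₂ refl
      types eq | alive at v s qs with At-just at eq
      -- `Active` inside `unfold` is what forces the type of a finished role to be literally `end`
      -- rather than a recursion.
      ... | unfold a _ = contradiction (Active-progress inv a at v s qs) stuck
      ... | done recv  = contradiction (Active-progress inv recv at v s qs) stuck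
      ... | done send  = contradiction (Active-progress inv send at v s qs) stuck
      ... | done end   = inj₁ refl
      ... | done stop  = inj₂ refl

      stops : ∀ q → proj₁ c q ≡ just stop → ∀ p → proj₂ c p q ≡ ⊘
      stops q eq with inv q
      ... | stopped _ _ ⊘s = ⊘s
      ... | alive at _ s _ = contradiction eq (At-not-stop at s)

      queues : ∀ p q → proj₁ c q ≢ just stop → proj₂ c p q ≡ ε
      queues p q ≢stop with inv q
      ... | stopped e _ _ = contradiction e ≢stop
      ... | alive at v s qs with qs p
      ...   | [] , e , _ = e
      ...   | _ ∷ _ , _ , x =
              contradiction (Active-progress inv (Pending-Active x s) at v s qs) stuck

  -- Fair paths

  ∈ᴺ-down : ∀ {m n} N → m ≤ n → n ∈ᴺ N → m ∈ᴺ N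
  ∈ᴺ-down (upTo l) m≤n n≤l = ≤-trans m≤n n≤l
  ∈ᴺ-down all      _   _   = tt

  path-Inv : ∀ (π : Path) {t} → Inv (Path.conf π 0) t →
             ∀ n → n ∈ᴺ Path.N π → ∃[ t ] Inv (Path.conf π n) t
  path-Inv π inv zero    _  = _ , inv
  path-Inv π inv (suc n) n∈ =
    let α , ok , st = Path.step π n n∈
    in step-∃Inv (α , (λ r _ → ok r) , st)
                 (path-Inv π inv n (∈ᴺ-down (Path.N π) (n≤1+n n) n∈))

  -- `Q` is what must still hold of the queue when the goal fires: for a waiting message, that it is
  -- at the head; for a waiting receiver, nothing. Until then only sends of `s` to `r` change this
  -- queue, and they append.
  module Fairness (π : Path) (fair : FairPath π) (s r : Role) (Q : List Message → Set)
                  (Q-∷ʳ : ∀ {τ b} → Q τ → Q (τ ∷ʳ b)) where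
    open Path π
    open FairPath fair

    Holds : Config → Set
    Holds c = ∃[ τ ] proj₂ c s r ≡ avail τ × Q τ

    Holds-step : ∀ {c c′ α} → (∀ p → α ≢ cr p) → ¬ Goal s r α → c —[ α ]→ c′ →
                 Holds c → Holds c′
    Holds-step {Γ , Δ} ok ¬g (send {p = p} {q} _ _ (_ , Δ≗)) (τ , e , h)
      with s ≟ p | r ≟ q | Δ≗ s r
    ... | yes refl | yes refl | e′ = _ , trans e′ (cong (_· _) e) , Q-∷ʳ h
    ... | no _     | _        | e′ = τ , trans e′ e , h
    ... | yes _    | no _     | e′ = τ , trans e′ e , h
    Holds-step ok ¬g (receive {p = p} {q} _ _ _ (_ , Δ≗)) (τ , e , h)
      with s ≟ q | r ≟ p | Δ≗ s r
    ... | yes refl | yes refl | _  = contradiction receives ¬g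
    ... | no _     | _        | e′ = τ , trans e′ e , h
    ... | yes _    | no _     | e′ = τ , trans e′ e , h
    Holds-step ok ¬g (rec _ st) h = Holds-step ok ¬g st h
    Holds-step ok ¬g (crash _ _ _ _) h = contradiction refl (ok _)
    Holds-step ok ¬g (detect _ _ _ _ (_ , Δ≗)) (τ , e , h) = τ , trans (Δ≗ s r) e , h

    Reached : ℕ → Set
    Reached n = ∃[ k ] k ≥ n × ∃[ α ] Goal s r α × Fires π k α × Holds (conf k)

    Reached-≤ : ∀ {m n} → m ≤ n → Reached n → Reached m
    Reached-≤ m≤n (k , n≤k , x) = k , ≤-trans m≤n n≤k , x

    root-fires : ∀ {n t α} → n ∈ᴺ N → RootAction t α → Enabled (conf n) α →
                 ∃[ k ] k ≥ n × ∃[ β ] RootAction t β × Fires π k β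
    root-fires n∈ sends en =
      let k , k≥n , b , f = F1 _ n∈ en in k , k≥n , _ , sends , f
    root-fires n∈ detects en =
      let k , k≥n , f = F3 _ n∈ en in k , k≥n , _ , detects , f
    root-fires n∈ receives en =
      let k , k≥n , f = F2 _ n∈ en in k , k≥n , _ , receives , f

    -- Each root action is fair and lowers the weight; the other actions on
    -- the way do not raise it and leave the root in place.
    reach : ∀ {w} → Acc _<_ w → ∀ {n t} → n ∈ᴺ N → Inv (conf n) t → Next s r w t →
            Holds (conf n) → Reached n
    walk  : ∀ {w} → (∀ {v} → v < w → Acc _<_ v) → ∀ {k β} → Fires π k β →
            ∀ d {n t} → d + n ≡ k → RootAction t β → Inv (conf n) t → Next s r w t →
            Holds (conf n) → Reached n

    reach (acc rs) n∈ inv x h@(_ , e , _) with root inv x (avail≢⊘ e)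
    ... | inj₂ (_ , _ , v<w , x′ , inv′) = reach (rs v<w) n∈ inv′ x′ h
    ... | inj₁ (α , ra , en) with root-fires n∈ ra en
    ...   | k , k≥n , β , rb , f with m≤n⇒∃[o]m+o≡n k≥n
    ...     | d , n+d≡k = walk rs f d (trans (+-comm d _) n+d≡k) rb inv x h

    walk rs {β = β} f@(sn∈ , st) zero {n} refl rb inv x h with goal? s r β
    ... | yes g = n , ≤-refl , β , g , f , h
    ... | no ¬g with step-Inv st (λ p _ → RootAction-no-crash rb p) inv
    ...   | _ , _ , l , tr , inv′ with advance ¬g tr (Next-≼ l x) (RootAction-≼ l rb)
    ...     | inj₁ (_ , v<w , x′) = Reached-≤ (n≤1+n _)
                (reach (rs v<w) sn∈ inv′ x′ (Holds-step (RootAction-no-crash rb) ¬g st h))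
    -- The action fired here is the root action itself, so only the lighter tree is possible.
    ...     | inj₂ (_ , β≢β) = contradiction refl β≢β
    walk rs f@(sk∈ , _) (suc d) {n} refl rb inv x h
      with ∈ᴺ-down N (s≤s (≤-trans (m≤n+m n d) (n≤1+n _))) sk∈
    ... | sn∈ with step n sn∈
    ...   | α , ok , st with goal? s r α
    ...     | yes g = n , ≤-refl , α , g , (sn∈ , st) , h
    ...     | no ¬g with step-Inv st (λ p _ → ok p) inv
    ...       | _ , _ , l , tr , inv′ with advance ¬g tr (Next-≼ l x) (RootAction-≼ l rb)
    ...         | inj₁ (_ , v<w , x′) = Reached-≤ (n≤1+n _)
                    (reach (rs v<w) sn∈ inv′ x′ (Holds-step ok ¬g st h))
    -- The same root action still fires at `k`, one step nearer.
    ...         | inj₂ (rb′ , _) = Reached-≤ (n≤1+n _)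
                    (walk rs f d (+-suc d n) rb′ inv′ (Next-Trans ¬g tr (Next-≼ l x))
                          (Holds-step ok ¬g st h))

  receive-head : ∀ {c c′ p q b b′ τ} → c —[ p & q ∶ b ]→ c′ → proj₂ c q p ≡ avail (b′ ∷ τ) →
                 b ≡ b′
  receive-head (receive _ _ e _) e′ with trans (sym e) e′
  ... | refl = refl
  receive-head (rec _ st) e′ = receive-head st e′

  detect-empty : ∀ {c c′ p q} → c —[ det q p ]→ c′ → proj₂ c p q ≡ ε
  detect-empty (detect _ _ _ e _) = e
  detect-empty (rec _ st)         = detect-empty st

  StartsWith : Message → List Message → Set
  StartsWith b τ = ∃[ σ ] τ ≡ b ∷ σ

  StartsWith-∷ʳ : ∀ {b b′ τ} → StartsWith b τ → StartsWith b (τ ∷ʳ b′)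
  StartsWith-∷ʳ (σ , refl) = _ , refl

  fair⇒live : ∀ (π : Path) {t} → Inv (Path.conf π 0) t → FairPath π → LivePath π
  fair⇒live π inv₀ fair = record { L1 = L1 ; L2 = L2 }
    where
    open Path π
    L1 : ∀ n → n ∈ᴺ N → ∀ {p q b τ} → Δ-at π n p q ≡ avail (b ∷ τ) → b ≢ crash →
         ∃[ k ] k ≥ n × Fires π k (q & p ∶ b)
    L1 n n∈ {p} {q} {b} eq _ with path-Inv π inv₀ n n∈
    ... | t , inv with inv q
    ...   | stopped _ _ ⊘s = contradiction (⊘s p) (avail≢⊘ eq)
    ...   | alive _ _ _ qs with qs p
    ...     | _ , e , x with trans (sym eq) e
    ...       | refl with Fairness.reach π fair p q (StartsWith b) StartsWith-∷ʳ
                               (<-wellFounded _) n∈ inv (proj₂ (Pending-Next x)) (_ , e , _ , refl)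
    -- The queue still starts with `b`, so whatever is received is `b`.
    ...         | k , k≥n , _ , receives , (k∈ , st) , _ , e′ , _ , refl =
                  k , k≥n , k∈ , subst (λ b → _ —[ q & p ∶ b ]→ _) (receive-head st e′) st
    -- Detection requires an empty queue.
    ...         | k , k≥n , _ , detects , (k∈ , st) , _ , e′ , _ , refl =
                  contradiction (trans (sym e′) (detect-empty st)) λ ()

    L2 : ∀ n → n ∈ᴺ N → ∀ {p q bs} → Γ-at π n p ≡ just (recv q bs) →
         ∃[ k ] k ≥ n × ((∃[ b ] Fires π k (p & q ∶ b)) ⊎ Fires π k (det p q))
    L2 n n∈ {p} {q} eq with path-Inv π inv₀ n n∈
    ... | t , inv with inv p
    ...   | stopped e _ _ = contradiction (trans (sym e) eq) λ ()
    ...   | alive at v s qs with At-just at eq | qs q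
    ...     | done _ | τ , e , _ with Sim-Next inv (At-Settled at v) s
    ...       | w , u , inv′ , x with Fairness.reach π fair q p (λ _ → ⊤) (λ _ → tt)
                                 (<-wellFounded w) n∈ inv′ x (τ , e , tt)
    ...         | k , k≥n , _ , receives , f , _ = k , k≥n , inj₁ (_ , f)
    ...         | k , k≥n , _ , detects  , f , _ = k , k≥n , inj₂ f

  Inv-Live : ∀ {c t} → Inv c t → Live R c
  Inv-Live inv = Inv-Safe inv , λ c′ st* π π₀≈c′ →
    fair⇒live π (Inv-≈ᶜ π₀≈c′ (proj₂ (reachable-Inv st* inv)))

  -- The initial configuration

  -- Covers roles that are ended or have no type. `Roles` unfolds recursions while `Absent` is
  -- syntactic; `OccursAt` bridges the two.
  absent-Follows : ∀ {p} {G : GType 0} → Proper G → ¬ Roles G p → Follows p end G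
  absent-Follows pr ¬r =
    end , end ,
    absent (¬Occurs⇒Absent pr (λ o → ¬r (OccursAt⇒Roles pr (proj₂ (Occurs⇒OccursAt pr o))))
                           (λ { {()} _ })) ,
    done end , (λ S T → S ≡ end × T ≡ end) , (λ { (refl , refl) → end }) , refl , refl

  Associated-Inv : ∀ {Γ G} → WFCtx Γ → (pr : Proper G) → Associated R (Γ , Δε) ∅ G →
                   Inv (Γ , Δε) (leaf G pr)
  Associated-Inv {Γ} {G} wfΓ pr as p = cases (splits p)
    where
    open CtxAssociated (Associated.context as)

    no-queues : ∀ q → ∃[ τ ] Δε q p ≡ avail τ × Pending q p τ (leaf G pr)
    no-queues q = [] , refl , leaf

    alive-end : At Γ p end → ΓG p ≡ nothing → RoleInv (Γ , Δε) (leaf G pr) p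
    alive-end at e = alive at end (leaf (absent-Follows pr ¬role)) no-queues
      where
      ¬role : ¬ Roles G p
      ¬role r with Equivalence.from (dom-ΓG p) r
      ... | _ , e′ = contradiction (trans (sym e) e′) λ ()

    cases : _ → RoleInv (Γ , Δε) (leaf G pr) p
    cases (inj₁ (e , _)) with Γ p in eq
    ... | nothing = alive-end (none eq) e
    ... | just S with subtype e
    ...   | T , proj , _≲_ , cl , S≲T =
            let v = WFL⇒Valid (wfΓ eq)
                P = Projects⇒Proj pr proj (⊒-refl T)
                H , S⇓H = Valid-⇓ v
                K , T⇓K = Proj-⇓ P
            in alive (some eq S⇓H) (⇓-Valid S⇓H v)
                     (leaf (T , K , P , T⇓K , _≲_ , cl , ≲-⇓ cl S⇓H T⇓K S≲T)) no-queues
    cases (inj₂ (inj₁ (e , e′ , _))) with Γ p in eq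
    ... | nothing = alive-end (none eq) e
    -- No role has crashed at the start.
    ... | just S  = ⊥-elim (Equivalence.to (dom-Γstop p) (S , e′))
    cases (inj₂ (inj₂ (e , _ , e′))) with Γ p in eq
    ... | nothing = alive-end (none eq) e
    ... | just S with ended e′
    ...   | refl = alive-end (some eq (done end)) e

theorem4p31 : (Role Name Basic : Set) (_≟_ : DecidableEquality Role) →
    let open CrashStop Role Name Basic _≟_ in
    (R : Pred Role 0ℓ) (G : GType 0) → WFG G → RuntimeFree G →
    (Γ : Ctx) → WFCtx Γ →
    Associated R (Γ , Δε) ∅ G →
    Safe R (Γ , Δε) × DeadlockFree R (Γ , Δε) × Live R (Γ , Δε)
theorem4p31 Role Name Basic _≟_ R G wfG rfG Γ wfΓ as =
  Inv-Safe inv , Inv-DeadlockFree inv , Inv-Live inv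
  where
  open Development Role Name Basic _≟_ R
  inv = Associated-Inv wfΓ (WFG⇒Proper wfG rfG) as
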